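{- There exists an $O(n)$-space data structure for the Consecutive Occurrences Counting problem with $O(m)$ query time. That is, given a text $T$ of length $n$ and an integer interval $[\alpha,\beta]$ for preprocessing, there is a data structure of size $O(n)$ that, given any pattern $P$ of length $m$, returns $|\mathrm{Occ}^{\alpha\beta}_T(P)|$ in $O(m)$ time.
   Context: $\mathrm{Occ}_T(P)$ is the set of starting positions of occurrences of the string $P$ in $T$; patterns have length $m\le n$. A pair $(i,j)$ is an $(\alpha,\beta)$-consecutive occurrence of $P$ in $T$ if $i,j \in \mathrm{Occ}_T(P)$, there is no other occurrence of $P$ between $i$ and $j$ (i.e., no element of $\mathrm{Occ}_T(P)$ strictly between $i$ and $j$, where $i<j$), and $\alpha \le j-i \le \beta$. The set of all these pairs is $\mathrm{Occ}^{\alpha\beta}_T(P)$. Space is measured in machine words in the standard word-RAM model. -}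

module Defs where

open import Data.Bool.Base using (Bool; true; false; if_then_else_; _∧_; _∨_; _xor_)
open import Data.Fin.Base as Fin using (Fin; toℕ; inject≤)
import Data.Fin.Properties as Fin
open import Data.Integer.Base as ℤ using (ℤ; +_)
import Data.Integer.Properties as ℤ
open import Data.List.Base
  using (List; []; _∷_; _++_; length; drop; head; map; filter; allFin; cartesianProduct)
open import Data.List.Relation.Binary.Prefix.Heterogeneous using (Prefix)
open import Data.List.Relation.Binary.Prefix.Heterogeneous.Properties using (prefix?)
open import Data.Maybe.Base using (Maybe; nothing; maybe′; fromMaybe)
open import Data.Nat.Base
open import Data.Nat.DivMod using (_mod_)
open import Data.Nat.Properties using (m^n≢0)
open import Data.Product.Base using (_×_; _,_)
open import Relation.Binary.PropositionalEquality using (_≡_)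
open import Relation.Nullary.Decidable using (Dec; _×-dec_; _→-dec_; ¬?)
open import Relation.Nullary.Negation using (¬_)

------------------------------------------------------------------------
-- Consecutive occurrences (positions are 0-based)

module _ {σ : ℕ} (T P : List (Fin σ)) where

  Position : Set
  Position = Fin (length T)

  Occ : Position → Set
  Occ i = Prefix _≡_ P (drop (toℕ i) T)

  ConsecutiveOcc : ℤ → ℤ → Position × Position → Set
  ConsecutiveOcc α β (i , j) =
      Occ i × Occ j
    × i Fin.< j
    × (∀ k → i Fin.< k → k Fin.< j → ¬ Occ k)
    × α ℤ.≤ gap × gap ℤ.≤ β
    where gap = + toℕ j ℤ.- + toℕ i

  occ? : ∀ i → Dec (Occ i)
  occ? i = prefix? Fin._≟_ P (drop (toℕ i) T)

  consecutiveOcc? : ∀ α β ij → Dec (ConsecutiveOcc α β ij)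
  consecutiveOcc? α β (i , j) =
          occ? i ×-dec occ? j
    ×-dec (i Fin.<? j)
    ×-dec Fin.all? (λ k → (i Fin.<? k) →-dec ((k Fin.<? j) →-dec ¬? (occ? k)))
    ×-dec (α ℤ.≤? _) ×-dec (_ ℤ.≤? β)

  countConsecutiveOcc : ℤ → ℤ → ℕ
  countConsecutiveOcc α β =
    length (filter (consecutiveOcc? α β)
                   (cartesianProduct (allFin (length T)) (allFin (length T))))

------------------------------------------------------------------------
-- Word RAM programs

data Op : Set where
  add sub mul div mod and or xor shl shr eq lt : Op

-- Registers are numbered by ℕ, but a program, being finite, only ever refers
-- to constantly many of them.
Reg : Set
Reg = ℕ

data Instr : Set where
  const : Reg → ℕ → Instr               -- r := c
  op    : Op → Reg → Reg → Reg → Instr  -- r := a ∘ b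
  load  : Reg → Reg → Instr             -- r := memory[a]
  store : Reg → Reg → Instr             -- memory[a] := r
  jump  : ℕ → Instr
  jumpz : Reg → ℕ → Instr               -- jump if r = 0

Program : Set
Program = List Instr

fetch : Program → ℕ → Maybe Instr
fetch p a = head (drop a p)

------------------------------------------------------------------------
-- Semantics with w-bit words

bit : Bool → ℕ
bit b = if b then 1 else 0

bitwise : (Bool → Bool → Bool) → ℕ → ℕ → ℕ → ℕ
bitwise f zero    x y = 0
bitwise f (suc w) x y =
  bit (f (x % 2 ≡ᵇ 1) (y % 2 ≡ᵇ 1)) + 2 * bitwise f w (x / 2) (y / 2)

-- Division by zero returns 0.
quot rem : ℕ → ℕ → ℕ
quot x zero    = 0
quot x (suc y) = x / suc y
rem x zero    = 0
rem x (suc y) = x % suc y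

module RAM (w : ℕ) where

  Word : Set
  Word = Fin (2 ^ w)

  word : ℕ → Word
  word x = _mod_ x (2 ^ w) {{m^n≢0 2 w}}

  -- The result of an operation before reduction modulo 2 ^ w.
  opℕ : Op → ℕ → ℕ → ℕ
  opℕ add x y = x + y
  opℕ sub x y = x + (2 ^ w ∸ y)
  opℕ mul x y = x * y
  opℕ div x y = quot x y
  opℕ mod x y = rem x y
  opℕ and x y = bitwise _∧_ w x y
  opℕ or  x y = bitwise _∨_ w x y
  opℕ xor x y = bitwise _xor_ w x y
  opℕ shl x y = x * 2 ^ y
  opℕ shr x y = quot x (2 ^ y)
  opℕ eq  x y = bit (x ≡ᵇ y)
  opℕ lt  x y = bit (x <ᵇ y)

  evalOp : Op → Word → Word → Word
  evalOp o x y = word (opℕ o (toℕ x) (toℕ y))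

  record State : Set where
    constructor state
    field
      pc     : ℕ
      regs   : Reg → Word
      memory : Word → Word

  open State public

  setReg : Reg → Word → (Reg → Word) → Reg → Word
  setReg r v R r′ = if r′ ≡ᵇ r then v else R r′

  setMem : Word → Word → (Word → Word) → Word → Word
  setMem a v M a′ = if toℕ a′ ≡ᵇ toℕ a then v else M a′

  exec : Instr → State → State
  exec (const r c)  (state k R M) = state (suc k) (setReg r (word c) R) M
  exec (op o r a b) (state k R M) = state (suc k) (setReg r (evalOp o (R a) (R b)) R) M
  exec (load r a)   (state k R M) = state (suc k) (setReg r (M (R a)) R) M
  exec (store r a)  (state k R M) = state (suc k) R (setMem (R a) (R r) M)
  exec (jump l)     (state k R M) = state l R M
  exec (jumpz r l)  (state k R M) = state (if toℕ (R r) ≡ᵇ 0 then l else suc k) R M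

  -- Unit cost per instruction.  A program halts by leaving its code, after
  -- which the state no longer changes.
  step : Program → State → State
  step p s = maybe′ (λ i → exec i s) s (fetch p (pc s))

  run : Program → ℕ → State → State
  run p zero    s = s
  run p (suc t) s = run p t (step p s)

  Halted : Program → State → Set
  Halted p s = fetch p (pc s) ≡ nothing

  cell : List Word → ℕ → Word
  cell ws a = fromMaybe (word 0) (head (drop a ws))

  encode : ∀ {σ} → .(σ ≤ 2 ^ w) → List (Fin σ) → List Word
  encode σ≤2^w = map (λ c → inject≤ c σ≤2^w)

  -- The data structure D occupies addresses 0, 1, …, the query string Q follows
  -- it, and every other cell is 0.  Register 0 holds the length of Q, register 1
  -- the address of its first character, and every other register 0.
  initial : List Word → List Word → State
  initial D Q = state 0 (cell (word (length Q) ∷ word (length D) ∷ []))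
                        (λ a → cell (D ++ Q) (toℕ a))

  -- After at most t steps the query has halted with the answer in register 0,
  -- leaving D intact for further queries.
  record Returns (p : Program) (D Q : List Word) (answer t : ℕ) : Set where
    final : State
    final = run p t (initial D Q)
    field
      halted    : Halted p final
      output    : toℕ (regs final 0) ≡ answer
      preserved : ∀ a → toℕ a < length D → memory final a ≡ cell D (toℕ a)

{-# OPTIONS --safe #-}
module Submission where

-- All occurrences of a pattern lie below one node of the compacted trie of the suffixes of T, and
-- the count depends only on that set of occurrences, so it is stored at the node.  A query descends
-- blindly, inspecting only the branching positions of P, and finally compares P with T at one
-- representative occurrence; a mismatch there means that P does not occur.  For constant time per
-- branching over an arbitrary alphabet, each node carries a two-level perfect hash table, made of
-- two trie nodes that test the same position.  Good hash functions exist by averaging over the odd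
-- multipliers of multiply-shift hashing, which needs no more than w-bit arithmetic.

open import Defs
open import Data.Bool.Base as Bool using (true; false; if_then_else_)
open import Data.Fin.Base as Fin using (Fin; toℕ)
import Data.Fin.Properties as Fin
open import Data.Integer.Base as ℤ using (ℤ)
import Data.Integer.Properties as ℤ
open import Data.Integer.Tactic.RingSolver as ℤ-Solver using ()
open import Data.List.Base
  using (List; []; _∷_; _++_; _∷ʳ_; length; map; drop; filter; deduplicate; allFin; cartesianProduct; upTo)
import Data.List.Membership.DecPropositional as DecMembership
open import Data.List.Membership.Propositional using (_∈_; find; lose)
open import Data.List.Membership.Propositional.Properties
  using (∈-filter⁺; ∈-filter⁻; ∈-map⁺; ∈-map⁻; ∈-deduplicate⁺; ∈-deduplicate⁻; ∈-upTo⁺; ∈-upTo⁻)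
open import Data.List.Properties
  using (length-map; length-drop; length-++; length-tabulate; length-upTo; length-filter; ++-assoc; drop-map;
         filter-≐; filter-none; filter-notAll)
open import Data.List.Relation.Binary.Prefix.Heterogeneous using (Prefix; []; _∷_)
open import Data.List.Relation.Unary.All as All using (All)
open import Data.List.Relation.Unary.All.Properties using (¬All⇒Any¬)
open import Data.List.Relation.Unary.AllPairs using ([]; _∷_)
open import Data.List.Relation.Unary.Any using (here; there)
open import Data.List.Relation.Unary.Unique.DecPropositional.Properties using (deduplicate-!)
open import Data.List.Relation.Unary.Unique.Propositional using (Unique)
import Data.List.Relation.Unary.Unique.Propositional.Properties as Unique
open import Data.Nat.Base
open import Data.Nat.Divisibility as ℕ∣ using (_∣_; divides)
open import Data.Nat.DivMod
  using (m≡m%n+[m/n]*n; m%n<n; m%n%n≡m%n; m<n⇒m%n≡m; [m+n]%n≡m%n; [m+kn]%n≡m%n; %-distribˡ-*; m/n≤m; m<n*o⇒m/o<n)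
open import Data.Nat.Induction using (<-rec)
open import Data.Nat.ListAction using (sum)
open import Data.Nat.Primality using (euclidsLemma; prime[2])
open import Data.Nat.Properties
open import Data.Nat.Tactic.RingSolver using (solve-∀)
open import Data.Product.Base using (Σ-syntax; ∃-syntax; _×_; _,_; proj₁; proj₂)
open import Data.Sum.Base using (_⊎_; inj₁; inj₂; [_,_]′)
open import Data.Unit.Base using (⊤; tt)
open import Relation.Binary.Definitions using (tri<; tri≈; tri>)
open import Relation.Binary.PropositionalEquality
open import Relation.Nullary.Decidable using (Dec; yes; no; does; _×-dec_; _→-dec_; ¬?)
open import Relation.Nullary.Negation using (¬_; contradiction)

indicator : {P : Set} → Dec P → ℕ
indicator d = bit (does d)

indicator≤1 : {P : Set} (d : Dec P) → indicator d ≤ 1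
indicator≤1 (yes _) = ≤-refl
indicator≤1 (no _)  = z≤n

indicator-yes : {P : Set} (d : Dec P) → P → indicator d ≡ 1
indicator-yes (yes _) _ = refl
indicator-yes (no ¬p) p = contradiction p ¬p

indicator-no : {P : Set} (d : Dec P) → ¬ P → indicator d ≡ 0
indicator-no (yes p) ¬p = contradiction p ¬p
indicator-no (no _)  _  = refl

indicator-cong : {P Q : Set} (d : Dec P) (e : Dec Q) → (P → Q) → (Q → P) → indicator d ≡ indicator e
indicator-cong (yes p) e f g = sym (indicator-yes e (f p))
indicator-cong (no ¬p) e f g = sym (indicator-no e (λ q → ¬p (g q)))

-- Finite sums over ranges, lists and pairs of list entries

∑ : ℕ → (ℕ → ℕ) → ℕ
∑ zero    f = 0
∑ (suc n) f = ∑ n f + f n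

∑ₗ : {A : Set} → List A → (A → ℕ) → ℕ
∑ₗ xs f = sum (map f xs)

∑-cong : ∀ n {f g : ℕ → ℕ} → (∀ i → f i ≡ g i) → ∑ n f ≡ ∑ n g
∑-cong zero    e≡ = refl
∑-cong (suc n) e≡ = cong₂ _+_ (∑-cong n e≡) (e≡ n)

∑-mono : ∀ n {f g : ℕ → ℕ} → (∀ i → i < n → f i ≤ g i) → ∑ n f ≤ ∑ n g
∑-mono zero    le = z≤n
∑-mono (suc n) le = +-mono-≤ (∑-mono n (λ i i<n → le i (m<n⇒m<1+n i<n))) (le n ≤-refl)

∑-const : ∀ n c → ∑ n (λ _ → c) ≡ n * c
∑-const zero    c = refl
∑-const (suc n) c = trans (cong (_+ c) (∑-const n c)) (+-comm (n * c) c)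

∑-distrib-+ : ∀ n (f g : ℕ → ℕ) → ∑ n (λ i → f i + g i) ≡ ∑ n f + ∑ n g
∑-distrib-+ zero    f g = refl
∑-distrib-+ (suc n) f g = trans (cong (_+ (f n + g n)) (∑-distrib-+ n f g)) (lemma (∑ n f) (∑ n g) (f n) (g n))
  where lemma : ∀ a b c d → a + b + (c + d) ≡ a + c + (b + d)
        lemma = solve-∀

∑-distrib-* : ∀ n c (f : ℕ → ℕ) → ∑ n (λ i → c * f i) ≡ c * ∑ n f
∑-distrib-* zero    c f = sym (*-zeroʳ c)
∑-distrib-* (suc n) c f = trans (cong (_+ c * f n) (∑-distrib-* n c f)) (sym (*-distribˡ-+ c (∑ n f) (f n)))

∑-swap : ∀ n k (f : ℕ → ℕ → ℕ) → ∑ n (λ i → ∑ k (λ j → f i j)) ≡ ∑ k (λ j → ∑ n (λ i → f i j))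
∑-swap zero    k f = sym (trans (∑-const k 0) (*-zeroʳ k))
∑-swap (suc n) k f = trans (cong (_+ ∑ k (f n)) (∑-swap n k f)) (sym (∑-distrib-+ k _ (f n)))

∑-head : ∀ n (f : ℕ → ℕ) → f 0 + ∑ n (λ i → f (suc i)) ≡ ∑ (suc n) f
∑-head zero    f = +-comm (f 0) 0
∑-head (suc n) f = trans (sym (+-assoc (f 0) _ (f (suc n)))) (cong (_+ f (suc n)) (∑-head n f))

-- Moving the window by one drops `f t` and gains `f (t + n)`, which are equal. The sums are
-- compared after adding `f t`, which avoids subtraction.
∑-periodic : ∀ n (f : ℕ → ℕ) → (∀ i → f (i + n) ≡ f i) → ∀ t → ∑ n (λ i → f (i + t)) ≡ ∑ n f
∑-periodic n f per zero    = ∑-cong n (λ i → cong f (+-identityʳ i))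
∑-periodic n f per (suc t) = trans (+-cancelˡ-≡ (f t) _ _ shifted) (∑-periodic n f per t)
  where
  open ≡-Reasoning
  g : ℕ → ℕ
  g i = f (i + t)
  shifted : f t + ∑ n (λ i → f (i + suc t)) ≡ f t + ∑ n g
  shifted = begin
    f t + ∑ n (λ i → f (i + suc t)) ≡⟨ cong (f t +_) (∑-cong n (λ i → cong f (+-suc i t))) ⟩
    g 0 + ∑ n (λ i → g (suc i))     ≡⟨ ∑-head n g ⟩
    ∑ n g + f (n + t)               ≡⟨ cong (λ x → ∑ n g + f x) (+-comm n t) ⟩
    ∑ n g + f (t + n)               ≡⟨ cong (∑ n g +_) (per t) ⟩
    ∑ n g + f t                     ≡⟨ +-comm (∑ n g) (f t) ⟩
    f t + ∑ n g                     ∎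

∑-zero : ∀ n (f : ℕ → ℕ) → (∀ i → i < n → f i ≡ 0) → ∑ n f ≡ 0
∑-zero n f e≡ = n≤0⇒n≡0 (≤-trans (∑-mono n (λ i i<n → ≤-reflexive (e≡ i i<n)))
                                 (≤-reflexive (trans (∑-const n 0) (*-zeroʳ n))))

∑-at-most-one : ∀ n {P : ℕ → Set} (P? : ∀ i → Dec (P i)) →
                (∀ i j → i < n → j < n → P i → P j → i ≡ j) → ∑ n (λ i → indicator (P? i)) ≤ 1
∑-at-most-one zero    P? uniq = z≤n
∑-at-most-one (suc n) P? uniq with P? n
... | no _  = ≤-trans (≤-reflexive (+-identityʳ _))
                      (∑-at-most-one n P? (λ i j i<n j<n → uniq i j (m<n⇒m<1+n i<n) (m<n⇒m<1+n j<n)))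
... | yes p = ≤-reflexive (cong (_+ 1) (∑-zero n _
                (λ i i<n → indicator-no (P? i) (λ q → <⇒≢ i<n (uniq i n (m<n⇒m<1+n i<n) ≤-refl q p)))))

∑-pointMass : ∀ n {k} (w : ℕ → ℕ) → k < n → ∑ n (λ i → indicator (k ≟ i) * w i) ≡ w k
∑-pointMass (suc n) {k} w k<1+n with k ≟ n
... | yes refl = trans (cong₂ _+_ (∑-zero n _ vanish) (cong (_* w n) (indicator-yes (k ≟ n) refl))) (+-identityʳ (w n))
  where
  vanish : ∀ i → i < n → indicator (n ≟ i) * w i ≡ 0
  vanish i i<n = cong (_* w i) (indicator-no (n ≟ i) (λ e≡ → <⇒≢ i<n (sym e≡)))
... | no k≢n = trans (cong₂ _+_ (∑-pointMass n w (≤∧≢⇒< (s≤s⁻¹ k<1+n) k≢n)) (cong (_* w n) (indicator-no (k ≟ n) k≢n)))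
                     (+-identityʳ (w k))

-- This is where randomness is removed: a bound on the average over all hash functions yields one
-- function that attains it.
∑-minimum : ∀ n .{{_ : NonZero n}} (f : ℕ → ℕ) c → ∑ n f ≤ n * c → ∃[ i ] f i ≤ c
∑-minimum (suc n) f c = go n
  where
  go : ∀ n → ∑ (suc n) f ≤ suc n * c → ∃[ i ] f i ≤ c
  go zero    le = 0 , subst (f 0 ≤_) (+-identityʳ c) le
  go (suc n) le with f (suc n) ≤? c
  ... | yes fn≤c = suc n , fn≤c
  ... | no  fn≰c = go n (+-cancelʳ-≤ c _ _ (≤-trans (+-monoʳ-≤ (∑ (suc n) f) (<⇒≤ (≰⇒> fn≰c)))
                                             (≤-trans le (≤-reflexive (+-comm c (suc n * c))))))

module _ {A : Set} where

  ∑ₗ-cong : (xs : List A) {f g : A → ℕ} → (∀ {x} → x ∈ xs → f x ≡ g x) → ∑ₗ xs f ≡ ∑ₗ xs g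
  ∑ₗ-cong []       e≡ = refl
  ∑ₗ-cong (x ∷ xs) e≡ = cong₂ _+_ (e≡ (here refl)) (∑ₗ-cong xs (λ x∈ → e≡ (there x∈)))

  ∑ₗ-mono : (xs : List A) {f g : A → ℕ} → (∀ {x} → x ∈ xs → f x ≤ g x) → ∑ₗ xs f ≤ ∑ₗ xs g
  ∑ₗ-mono []       le = z≤n
  ∑ₗ-mono (x ∷ xs) le = +-mono-≤ (le (here refl)) (∑ₗ-mono xs (λ x∈ → le (there x∈)))

  ∑ₗ-const : (xs : List A) (c : ℕ) → ∑ₗ xs (λ _ → c) ≡ length xs * c
  ∑ₗ-const []       c = refl
  ∑ₗ-const (x ∷ xs) c = cong (c +_) (∑ₗ-const xs c)

  ∑ₗ-distrib-+ : (xs : List A) (f g : A → ℕ) → ∑ₗ xs (λ x → f x + g x) ≡ ∑ₗ xs f + ∑ₗ xs g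
  ∑ₗ-distrib-+ []       f g = refl
  ∑ₗ-distrib-+ (x ∷ xs) f g = trans (cong (f x + g x +_) (∑ₗ-distrib-+ xs f g)) (lemma (f x) (g x) (∑ₗ xs f) (∑ₗ xs g))
    where lemma : ∀ a b c d → a + b + (c + d) ≡ a + c + (b + d)
          lemma = solve-∀

  ∑ₗ-distrib-* : (xs : List A) (c : ℕ) (f : A → ℕ) → ∑ₗ xs (λ x → c * f x) ≡ c * ∑ₗ xs f
  ∑ₗ-distrib-* []       c f = sym (*-zeroʳ c)
  ∑ₗ-distrib-* (x ∷ xs) c f = trans (cong (c * f x +_) (∑ₗ-distrib-* xs c f)) (sym (*-distribˡ-+ c (f x) (∑ₗ xs f)))

  ∑ₗ-term-≤ : (xs : List A) (f : A → ℕ) {x : A} → x ∈ xs → f x ≤ ∑ₗ xs f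
  ∑ₗ-term-≤ (x ∷ xs) f (here refl) = m≤m+n (f x) _
  ∑ₗ-term-≤ (x ∷ xs) f (there x∈)  = ≤-trans (∑ₗ-term-≤ xs f x∈) (m≤n+m _ (f x))

  ∑-∑ₗ-swap : ∀ n (xs : List A) (f : ℕ → A → ℕ) → ∑ n (λ i → ∑ₗ xs (f i)) ≡ ∑ₗ xs (λ x → ∑ n (λ i → f i x))
  ∑-∑ₗ-swap n []       f = trans (∑-const n 0) (*-zeroʳ n)
  ∑-∑ₗ-swap n (x ∷ xs) f = trans (∑-distrib-+ n (λ i → f i x) _) (cong (∑ n (λ i → f i x) +_) (∑-∑ₗ-swap n xs f))

  ∑ₗ-filter : {P : A → Set} (P? : ∀ x → Dec (P x)) (xs : List A) (f : A → ℕ) →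
              ∑ₗ (filter P? xs) f ≡ ∑ₗ xs (λ x → indicator (P? x) * f x)
  ∑ₗ-filter P? []       f = refl
  ∑ₗ-filter P? (x ∷ xs) f with P? x
  ... | yes _ = cong₂ _+_ (sym (+-identityʳ (f x))) (∑ₗ-filter P? xs f)
  ... | no _  = ∑ₗ-filter P? xs f

  length-filter-∑ₗ : {P : A → Set} (P? : ∀ x → Dec (P x)) (xs : List A) →
                     length (filter P? xs) ≡ ∑ₗ xs (λ x → indicator (P? x))
  length-filter-∑ₗ P? []       = refl
  length-filter-∑ₗ P? (x ∷ xs) with P? x
  ... | yes _ = cong suc (length-filter-∑ₗ P? xs)
  ... | no _  = length-filter-∑ₗ P? xs

  ∑ₗ-unique : {P : A → Set} (P? : ∀ x → Dec (P x)) {xs : List A} → Unique xs →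
              (∀ {x y} → P x → P y → x ≡ y) → ∑ₗ xs (λ x → indicator (P? x)) ≤ 1
  ∑ₗ-unique P? []                 same = z≤n
  ∑ₗ-unique P? {x ∷ xs} (x∉ ∷ uq) same with P? x
  ... | no _  = ∑ₗ-unique P? uq same
  ... | yes p = ≤-reflexive (cong suc (trans
                  (∑ₗ-cong xs (λ {y} y∈ → indicator-no (P? y) (λ q → All.lookup x∉ y∈ (same p q))))
                  (trans (∑ₗ-const xs 0) (*-zeroʳ (length xs)))))

  -- Each pair of list positions is counted once, the earlier entry first. Hence `#pairs` is a
  -- binomial coefficient of the length, and a lemma that does not know the order of two entries
  -- asks for a symmetric `F`.
  ∑₂ : List A → (A → A → ℕ) → ℕ
  ∑₂ []       F = 0
  ∑₂ (x ∷ xs) F = ∑ₗ xs (F x) + ∑₂ xs F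

  #pairs : List A → ℕ
  #pairs xs = ∑₂ xs (λ _ _ → 1)

  ∑₂-mono : {xs : List A} {F G : A → A → ℕ} → Unique xs → (∀ {x y} → x ≢ y → F x y ≤ G x y) → ∑₂ xs F ≤ ∑₂ xs G
  ∑₂-mono []                 le = z≤n
  ∑₂-mono {x ∷ xs} (x∉ ∷ uq) le = +-mono-≤ (∑ₗ-mono xs (λ y∈ → le (All.lookup x∉ y∈))) (∑₂-mono uq le)

  ∑₂-cong : (xs : List A) {F G : A → A → ℕ} → (∀ x y → F x y ≡ G x y) → ∑₂ xs F ≡ ∑₂ xs G
  ∑₂-cong []       e≡ = refl
  ∑₂-cong (x ∷ xs) e≡ = cong₂ _+_ (∑ₗ-cong xs (λ {y} _ → e≡ x y)) (∑₂-cong xs e≡)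

  ∑₂-distrib-* : (xs : List A) (c : ℕ) (F : A → A → ℕ) → ∑₂ xs (λ x y → c * F x y) ≡ c * ∑₂ xs F
  ∑₂-distrib-* []       c F = sym (*-zeroʳ c)
  ∑₂-distrib-* (x ∷ xs) c F = trans (cong₂ _+_ (∑ₗ-distrib-* xs c (F x)) (∑₂-distrib-* xs c F))
                                    (sym (*-distribˡ-+ c (∑ₗ xs (F x)) (∑₂ xs F)))

  ∑-∑₂-swap : ∀ n (xs : List A) (F : ℕ → A → A → ℕ) →
              ∑ n (λ i → ∑₂ xs (F i)) ≡ ∑₂ xs (λ x y → ∑ n (λ i → F i x y))
  ∑-∑₂-swap n []       F = trans (∑-const n 0) (*-zeroʳ n)
  ∑-∑₂-swap n (x ∷ xs) F = trans (∑-distrib-+ n (λ i → ∑ₗ xs (F i x)) _)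
                                 (cong₂ _+_ (∑-∑ₗ-swap n xs (λ i → F i x)) (∑-∑₂-swap n xs F))

  #pairs-filter : {P : A → Set} (P? : ∀ x → Dec (P x)) (xs : List A) →
                  #pairs (filter P? xs) ≡ ∑₂ xs (λ x y → indicator (P? x) * indicator (P? y))
  #pairs-filter P? []       = refl
  #pairs-filter P? (x ∷ xs) with P? x
  ... | yes _ = cong₂ _+_ (trans (∑ₗ-filter P? xs (λ _ → 1))
                                 (∑ₗ-cong xs (λ {y} _ → *-comm (indicator (P? y)) 1)))
                          (#pairs-filter P? xs)
  ... | no _  = trans (#pairs-filter P? xs) (sym (cong (_+ ∑₂ xs (λ y z → indicator (P? y) * indicator (P? z)))
                  (trans (∑ₗ-const xs 0) (*-zeroʳ (length xs)))))

  #pairs-bound : (xs : List A) → 2 * #pairs xs ≤ length xs * length xs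
  #pairs-bound []       = z≤n
  #pairs-bound (x ∷ xs) = begin
    2 * (∑ₗ xs (λ _ → 1) + #pairs xs)  ≡⟨ cong (λ k → 2 * (k + #pairs xs)) (trans (∑ₗ-const xs 1) (*-identityʳ n)) ⟩
    2 * (n + #pairs xs)                ≡⟨ *-distribˡ-+ 2 n (#pairs xs) ⟩
    2 * n + 2 * #pairs xs              ≤⟨ +-monoʳ-≤ (2 * n) (#pairs-bound xs) ⟩
    2 * n + n * n                      ≤⟨ n≤1+n _ ⟩
    suc (2 * n + n * n)                ≡⟨ square n ⟩
    suc n * suc n                      ∎
    where
    open ≤-Reasoning
    n = length xs
    square : ∀ n → suc (2 * n + n * n) ≡ suc n * suc n
    square = solve-∀

  ∑₂-term-≤ : (xs : List A) (F : A → A → ℕ) → (∀ x y → F x y ≡ F y x) →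
              ∀ {x y} → x ∈ xs → y ∈ xs → x ≢ y → F x y ≤ ∑₂ xs F
  ∑₂-term-≤ (z ∷ xs) F sy (here refl) (here refl) x≢y = contradiction refl x≢y
  ∑₂-term-≤ (z ∷ xs) F sy (here refl) (there y∈)  x≢y = ≤-trans (∑ₗ-term-≤ xs (F z) y∈) (m≤m+n _ _)
  ∑₂-term-≤ (z ∷ xs) F sy {x} (there x∈) (here refl) x≢y =
    ≤-trans (≤-reflexive (sy x z)) (≤-trans (∑ₗ-term-≤ xs (F z) x∈) (m≤m+n _ _))
  ∑₂-term-≤ (z ∷ xs) F sy (there x∈) (there y∈) x≢y =
    ≤-trans (∑₂-term-≤ xs F sy x∈ y∈ x≢y) (m≤n+m _ (∑ₗ xs (F z)))

∑ₗ-swap : {A B : Set} (xs : List A) (ys : List B) (f : A → B → ℕ) →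
          ∑ₗ xs (λ x → ∑ₗ ys (f x)) ≡ ∑ₗ ys (λ y → ∑ₗ xs (λ x → f x y))
∑ₗ-swap []       ys f = sym (trans (∑ₗ-const ys 0) (*-zeroʳ (length ys)))
∑ₗ-swap (x ∷ xs) ys f = trans (cong (∑ₗ ys (f x) +_) (∑ₗ-swap xs ys f)) (sym (∑ₗ-distrib-+ ys (f x) _))

-- Multiply-shift hashing with odd multipliers

Odd : ℕ → Set
Odd n = ¬ (2 ∣ n)

1+2n-odd : ∀ n → Odd (1 + 2 * n)
1+2n-odd n 2∣ = contradiction (ℕ∣.∣1⇒≡1 (ℕ∣.∣m+n∣m⇒∣n (subst (2 ∣_) (+-comm 1 (2 * n)) 2∣) (ℕ∣.m∣m*n n))) λ ()

2^-cancel-odd : ∀ l {a d} → Odd a → 2 ^ l ∣ a * d → 2 ^ l ∣ d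
2^-cancel-odd zero        odd _ = ℕ∣.1∣ _
2^-cancel-odd (suc l) {a} {d} odd p with euclidsLemma a d prime[2] (ℕ∣.∣-trans (ℕ∣.m∣m*n (2 ^ l)) p)
... | inj₁ 2∣a = contradiction 2∣a odd
... | inj₂ (divides c refl) = subst (2 ^ suc l ∣_) (*-comm 2 c) (ℕ∣.*-monoʳ-∣ 2 (2^-cancel-odd l odd
        (ℕ∣.*-cancelˡ-∣ 2 (subst (2 * 2 ^ l ∣_) (rearrange a c) p))))
  where rearrange : ∀ a c → a * (c * 2) ≡ 2 * (a * c)
        rearrange = solve-∀

odd-part : ∀ z → 0 < z → ∃[ k ] ∃[ ζ ] (z ≡ 2 ^ k * ζ × Odd ζ)
odd-part = <-rec _ go
  where
  go : ∀ z → (∀ {y} → y < z → 0 < y → ∃[ k ] ∃[ ζ ] (y ≡ 2 ^ k * ζ × Odd ζ)) →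
       0 < z → ∃[ k ] ∃[ ζ ] (z ≡ 2 ^ k * ζ × Odd ζ)
  go z rec 0<z with 2 ℕ∣.∣? z
  ... | no odd = 0 , z , sym (+-identityʳ z) , odd
  go z rec 0<z | yes (divides (suc y) refl) with rec (m<m*n (suc y) 2 ≤-refl) (s≤s z≤n)
  ... | k , ζ , e≡ , odd = suc k , ζ , trans (cong (_* 2) e≡) (rearrange (2 ^ k) ζ) , odd
    where rearrange : ∀ p ζ → p * ζ * 2 ≡ 2 * p * ζ
          rearrange = solve-∀

_%2^_ _/2^_ : ℕ → ℕ → ℕ
x %2^ w = _%_ x (2 ^ w) {{m^n≢0 2 w}}
x /2^ w = _/_ x (2 ^ w) {{m^n≢0 2 w}}

-- Multiply-shift hashing of Dietzfelbinger et al., into 2 ^ l buckets.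
hash : (w l a x : ℕ) → ℕ
hash w l a x = ((x * a) %2^ w) /2^ (w ∸ l)

hash<2^l : ∀ w l a x → hash w l a x < 2 ^ l
hash<2^l w l a x = m<n*o⇒m/o<n {{m^n≢0 2 (w ∸ l)}}
  (<-≤-trans (m%n<n (x * a) (2 ^ w) {{m^n≢0 2 w}})
    -- `l` may exceed `w`; then `w ∸ l` is 0, and of the expected equality only `w ≤ l + (w ∸ l)` is
    -- left.
    (≤-trans (^-monoʳ-≤ 2 (m≤n+m∸n w l)) (≤-reflexive (^-distribˡ-+-* 2 l (w ∸ l)))))

-- The multiplier matters only modulo `2 ^ w`, so sets of multipliers can be translated cyclically.
hash-periodic : ∀ w l a x → hash w l (a + 2 ^ w) x ≡ hash w l a x
hash-periodic w l a x = cong (_/2^ (w ∸ l)) (trans (cong (_%2^ w) (*-distribˡ-+ x a (2 ^ w)))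
                                                   ([m+kn]%n≡m%n (x * a) x (2 ^ w) {{m^n≢0 2 w}}))

module _ where

  open import Data.Integer.Base using (+_)

  small-multiple : ∀ {t s c} → ℤ.∣ t ∣ < c → t ≡ s ℤ.* + c → s ≡ + 0
  small-multiple {s = s} {c} t<c refl = ℤ.∣i∣≡0⇒i≡0 (zero-factor ℤ.∣ s ∣ (subst (_< c) (ℤ.abs-* s (+ c)) t<c))
    where
    zero-factor : ∀ s {c} → s * c < c → s ≡ 0
    zero-factor zero    _  = refl
    zero-factor (suc s) lt′ = contradiction lt′ (≤⇒≯ (m≤m+n _ (s * _)))

  -- The residue of `a * z` modulo `N` lies in the open window of radius `M` around 0. The witnesses
  -- are integers because the window has two sides.
  Near : (M N a z : ℕ) → Set
  Near M N a z = Σ[ e ∈ ℤ ] Σ[ q ∈ ℤ ] (ℤ.∣ e ∣ < M × + a ℤ.* + z ≡ e ℤ.+ q ℤ.* + N)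

  -- `2 ^ r` divides both `z` and the modulus, hence also `e`, which is smaller in absolute value
  -- and therefore 0. So the modulus divides `a * z`, and then `z` because `a` is odd, against
  -- `0 < z < 2 ^ w`.
  near-multiple : ∀ {a z w k ζ} r → Odd a → 0 < z → z < 2 ^ w → z ≡ 2 ^ k * ζ → r ≤ k → r ≤ w → ¬ Near (2 ^ r) (2 ^ w) a z
  near-multiple {a} {z} {w} {k} {ζ} r odd 0<z z<N refl r≤k r≤w (e , q , e<M , e≡) =
    contradiction (2^-cancel-odd w odd N∣az) (ℕ∣.>⇒∤ {{>-nonZero 0<z}} z<N)
    where
    c = 2 ^ (k ∸ r)
    d = 2 ^ (w ∸ r)
    M = 2 ^ r
    2^k : 2 ^ k ≡ c * M
    2^k = trans (cong (2 ^_) (sym (m∸n+n≡m r≤k))) (^-distribˡ-+-* 2 (k ∸ r) r)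
    2^w : 2 ^ w ≡ d * M
    2^w = trans (cong (2 ^_) (sym (m∸n+n≡m r≤w))) (^-distribˡ-+-* 2 (w ∸ r) r)
    open ≡-Reasoning
    s : ℤ
    s = + a ℤ.* (+ c ℤ.* + ζ) ℤ.- q ℤ.* + d
    e-multiple : e ≡ s ℤ.* + M
    e-multiple = begin
      e                                                                ≡⟨ add-sub e (q ℤ.* + (2 ^ w)) ⟩
      (e ℤ.+ q ℤ.* + (2 ^ w)) ℤ.- q ℤ.* + (2 ^ w)                      ≡⟨ cong (ℤ._- q ℤ.* + (2 ^ w)) (sym e≡) ⟩
      + a ℤ.* + (2 ^ k * ζ) ℤ.- q ℤ.* + (2 ^ w)                        ≡⟨ cong₂ (λ x y → + a ℤ.* + (x * ζ) ℤ.- q ℤ.* + y) 2^k 2^w ⟩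
      + a ℤ.* + (c * M * ζ) ℤ.- q ℤ.* + (d * M)                        ≡⟨ cong₂ (λ x y → + a ℤ.* x ℤ.- q ℤ.* y) (trans (ℤ.pos-* (c * M) ζ) (cong (ℤ._* + ζ) (ℤ.pos-* c M))) (ℤ.pos-* d M) ⟩
      + a ℤ.* (+ c ℤ.* + M ℤ.* + ζ) ℤ.- q ℤ.* (+ d ℤ.* + M)            ≡⟨ factor (+ a) (+ c) (+ M) (+ ζ) q (+ d) ⟩
      (+ a ℤ.* (+ c ℤ.* + ζ) ℤ.- q ℤ.* + d) ℤ.* + M                    ∎
      where
      add-sub : ∀ e x → e ≡ (e ℤ.+ x) ℤ.- x
      add-sub = ℤ-Solver.solve-∀
      factor : ∀ a c M ζ q d → a ℤ.* (c ℤ.* M ℤ.* ζ) ℤ.- q ℤ.* (d ℤ.* M) ≡ (a ℤ.* (c ℤ.* ζ) ℤ.- q ℤ.* d) ℤ.* M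
      factor = ℤ-Solver.solve-∀
    e≡0 : e ≡ + 0
    e≡0 = trans e-multiple (trans (cong (ℤ._* + M) (small-multiple {s = s} e<M e-multiple)) (ℤ.*-zeroˡ (+ M)))
    az≡qN : + (a * z) ≡ q ℤ.* + (2 ^ w)
    az≡qN = trans (ℤ.pos-* a z) (trans e≡ (trans (cong (ℤ._+ q ℤ.* + (2 ^ w)) e≡0) (ℤ.+-identityˡ _)))
    N∣az : 2 ^ w ∣ a * z
    N∣az = divides ℤ.∣ q ∣ (trans (cong ℤ.∣_∣ az≡qN) (ℤ.abs-* q (+ (2 ^ w))))

  ∣i-j∣<⇒≡ : ∀ {i j L} → i < L → j < L → L ∣ ℤ.∣ + i ℤ.- + j ∣ → i ≡ j
  ∣i-j∣<⇒≡ {i} {j} {L} i<L j<L L∣ with ℤ.∣ + i ℤ.- + j ∣ in e≡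
  ... | zero  = ℤ.+-injective (ℤ.i-j≡0⇒i≡j (+ i) (+ j) (ℤ.∣i∣≡0⇒i≡0 e≡))
  ... | suc d = contradiction L∣ (ℕ∣.>⇒∤ (subst (_< L) e≡ bound))
    where
    bound : ℤ.∣ + i ℤ.- + j ∣ < L
    bound = ≤-<-trans (≤-trans (≤-reflexive (cong ℤ.∣_∣ (ℤ.m-n≡m⊖n i j))) (ℤ.∣m⊝n∣≤m⊔n i j)) (⊔-lub i<L j<L)

  -- Moving the multiplier by 2τ moves a · z by an odd multiple of 2M modulo 2ML, so that the 2 ^ l
  -- translates of the window of width 2M around 0 are disjoint.
  near-translates : ∀ {M τ z ζ u} l → M * ζ ≡ τ * z → Odd ζ → ∀ {i j} → i < 2 ^ l → j < 2 ^ l →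
                    Near M (2 * M * 2 ^ l) (1 + 2 * (u + i * τ)) z →
                    Near M (2 * M * 2 ^ l) (1 + 2 * (u + j * τ)) z → i ≡ j
  near-translates {M} {τ} {z} {ζ} {u} l Mζ≡τz odd {i} {j} i<L j<L (e , q , e<M , e≡) (e′ , q′ , e′<M , e≡′) =
    ∣i-j∣<⇒≡ i<L j<L (2^-cancel-odd l odd L∣)
    where
    L = 2 ^ l
    s = + ζ ℤ.* (+ i ℤ.- + j) ℤ.- (q ℤ.- q′) ℤ.* + L
    open ≡-Reasoning
    expand : ∀ i → + (1 + 2 * (u + i * τ)) ℤ.* + z ≡ + z ℤ.+ + 2 ℤ.* + u ℤ.* + z ℤ.+ + 2 ℤ.* + i ℤ.* (+ M ℤ.* + ζ)
    expand i = begin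
      + (1 + 2 * (u + i * τ)) ℤ.* + z                                            ≡⟨ sym (ℤ.pos-* (1 + 2 * (u + i * τ)) z) ⟩
      + ((1 + 2 * (u + i * τ)) * z)                                              ≡⟨ cong +_ (spread u i τ z) ⟩
      + (z + 2 * u * z + 2 * i * (τ * z))                                        ≡⟨ cong (λ x → + (z + 2 * u * z + 2 * i * x)) (sym Mζ≡τz) ⟩
      + (z + 2 * u * z + 2 * i * (M * ζ))                                        ≡⟨ ℤ.pos-+ (z + 2 * u * z) _ ⟩
      + (z + 2 * u * z) ℤ.+ + (2 * i * (M * ζ))                                  ≡⟨ cong₂ ℤ._+_ (ℤ.pos-+ z _) (trans (ℤ.pos-* (2 * i) (M * ζ)) (cong₂ ℤ._*_ (ℤ.pos-* 2 i) (ℤ.pos-* M ζ))) ⟩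
      + z ℤ.+ + (2 * u * z) ℤ.+ + 2 ℤ.* + i ℤ.* (+ M ℤ.* + ζ)                    ≡⟨ cong (λ x → + z ℤ.+ x ℤ.+ + 2 ℤ.* + i ℤ.* (+ M ℤ.* + ζ)) (trans (ℤ.pos-* (2 * u) z) (cong (ℤ._* + z) (ℤ.pos-* 2 u))) ⟩
      + z ℤ.+ + 2 ℤ.* + u ℤ.* + z ℤ.+ + 2 ℤ.* + i ℤ.* (+ M ℤ.* + ζ)              ∎
      where spread : ∀ u i τ z → (1 + 2 * (u + i * τ)) * z ≡ z + 2 * u * z + 2 * i * (τ * z)
            spread = solve-∀
    N≡ : + (2 * M * L) ≡ + 2 ℤ.* + M ℤ.* + L
    N≡ = trans (ℤ.pos-* (2 * M) L) (cong (ℤ._* + L) (ℤ.pos-* 2 M))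
    solved : ∀ i e q → + (1 + 2 * (u + i * τ)) ℤ.* + z ≡ e ℤ.+ q ℤ.* + (2 * M * L) →
             e ≡ + z ℤ.+ + 2 ℤ.* + u ℤ.* + z ℤ.+ + 2 ℤ.* + i ℤ.* (+ M ℤ.* + ζ) ℤ.- q ℤ.* (+ 2 ℤ.* + M ℤ.* + L)
    solved i e q eqn = begin
      e                                                ≡⟨ add-sub e (q ℤ.* + (2 * M * L)) ⟩
      (e ℤ.+ q ℤ.* + (2 * M * L)) ℤ.- q ℤ.* + (2 * M * L) ≡⟨ cong₂ (λ x y → x ℤ.- q ℤ.* y) (trans (sym eqn) (expand i)) N≡ ⟩
      _ ∎
      where
      add-sub : ∀ e x → e ≡ (e ℤ.+ x) ℤ.- x
      add-sub = ℤ-Solver.solve-∀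
    difference : e ℤ.- e′ ≡ s ℤ.* + (2 * M)
    difference = begin
      e ℤ.- e′ ≡⟨ cong₂ ℤ._-_ (solved i e q e≡) (solved j e′ q′ e≡′) ⟩
      _        ≡⟨ factor (+ z ℤ.+ + 2 ℤ.* + u ℤ.* + z) (+ i) (+ j) (+ M) (+ ζ) q q′ (+ L) ⟩
      s ℤ.* (+ 2 ℤ.* + M) ≡⟨ cong (s ℤ.*_) (sym (ℤ.pos-* 2 M)) ⟩
      s ℤ.* + (2 * M) ∎
      where
      factor : ∀ b i j M ζ q q′ L →
        (b ℤ.+ + 2 ℤ.* i ℤ.* (M ℤ.* ζ) ℤ.- q ℤ.* (+ 2 ℤ.* M ℤ.* L)) ℤ.- (b ℤ.+ + 2 ℤ.* j ℤ.* (M ℤ.* ζ) ℤ.- q′ ℤ.* (+ 2 ℤ.* M ℤ.* L))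
        ≡ (ζ ℤ.* (i ℤ.- j) ℤ.- (q ℤ.- q′) ℤ.* L) ℤ.* (+ 2 ℤ.* M)
      factor = ℤ-Solver.solve-∀
    s≡0 : s ≡ + 0
    s≡0 = small-multiple {t = e ℤ.- e′} {s = s} (≤-<-trans (ℤ.∣i-j∣≤∣i∣+∣j∣ e e′)
            (subst (ℤ.∣ e ∣ + ℤ.∣ e′ ∣ <_) (cong (λ t → M + t) (sym (+-identityʳ M))) (+-mono-< e<M e′<M))) difference
    L∣ : L ∣ ζ * ℤ.∣ + i ℤ.- + j ∣
    L∣ = divides ℤ.∣ q ℤ.- q′ ∣ (begin
      ζ * ℤ.∣ + i ℤ.- + j ∣              ≡⟨ sym (ℤ.abs-* (+ ζ) (+ i ℤ.- + j)) ⟩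
      ℤ.∣ + ζ ℤ.* (+ i ℤ.- + j) ∣        ≡⟨ cong ℤ.∣_∣ (ℤ.i-j≡0⇒i≡j (+ ζ ℤ.* (+ i ℤ.- + j)) ((q ℤ.- q′) ℤ.* + L) s≡0) ⟩
      ℤ.∣ (q ℤ.- q′) ℤ.* + L ∣           ≡⟨ ℤ.abs-* (q ℤ.- q′) (+ L) ⟩
      ℤ.∣ q ℤ.- q′ ∣ * L                 ∎)

  -- Equal hashes put `x * a` and `y * a`, reduced modulo `2 ^ w`, into the same block of length
  -- `2 ^ (w ∸ l)`; their offsets within the block differ by less than that length.
  collision⇒near : ∀ w l a {x y z} → x ≡ y + z → hash w l a x ≡ hash w l a y → Near (2 ^ (w ∸ l)) (2 ^ w) a z
  collision⇒near w l a {x} {y} {z} x≡y+z e≡ =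
    + rX ℤ.- + rY , + qX ℤ.- + qY ,
    ≤-<-trans (≤-trans (≤-reflexive (cong ℤ.∣_∣ (ℤ.m-n≡m⊖n rX rY))) (ℤ.∣m⊝n∣≤m⊔n rX rY))
              (⊔-lub (m%n<n ((x * a) %2^ w) M) (m%n<n ((y * a) %2^ w) M)) ,
    equation
    where
    N = 2 ^ w
    M = 2 ^ (w ∸ l)
    instance
      _ = m^n≢0 2 w
      _ = m^n≢0 2 (w ∸ l)
    h = hash w l a y
    qX = (x * a) / N
    qY = (y * a) / N
    rX = (x * a) % N % M
    rY = (y * a) % N % M
    decompose : ∀ x → h ≡ hash w l a x → + x ℤ.* + a ≡ + ((x * a) % N % M) ℤ.+ + h ℤ.* + M ℤ.+ + ((x * a) / N) ℤ.* + N
    decompose x h≡ = begin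
      + x ℤ.* + a                                             ≡⟨ sym (ℤ.pos-* x a) ⟩
      + (x * a)                                               ≡⟨ cong +_ (m≡m%n+[m/n]*n (x * a) N) ⟩
      + ((x * a) % N + (x * a) / N * N)                       ≡⟨ cong (λ t → + (t + (x * a) / N * N)) (trans (m≡m%n+[m/n]*n ((x * a) % N) M) (cong (λ t → (x * a) % N % M + t * M) (sym h≡))) ⟩
      + ((x * a) % N % M + h * M + (x * a) / N * N)           ≡⟨ trans (ℤ.pos-+ ((x * a) % N % M + h * M) _) (cong₂ ℤ._+_ (trans (ℤ.pos-+ ((x * a) % N % M) (h * M)) (cong (ℤ._+_ (+ ((x * a) % N % M))) (ℤ.pos-* h M))) (ℤ.pos-* ((x * a) / N) N)) ⟩
      + ((x * a) % N % M) ℤ.+ + h ℤ.* + M ℤ.+ + ((x * a) / N) ℤ.* + N ∎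
      where open ≡-Reasoning
    equation : + a ℤ.* + z ≡ (+ rX ℤ.- + rY) ℤ.+ (+ qX ℤ.- + qY) ℤ.* + N
    equation = begin
      + a ℤ.* + z                                   ≡⟨ shift (+ a) (+ y) (+ z) ⟩
      (+ y ℤ.+ + z) ℤ.* + a ℤ.- + y ℤ.* + a         ≡⟨ cong (λ t → t ℤ.* + a ℤ.- + y ℤ.* + a) (trans (sym (ℤ.pos-+ y z)) (cong +_ (sym x≡y+z))) ⟩
      + x ℤ.* + a ℤ.- + y ℤ.* + a                   ≡⟨ cong₂ ℤ._-_ (decompose x (sym e≡)) (decompose y refl) ⟩
      _                                             ≡⟨ cancel (+ rX) (+ rY) (+ h) (+ M) (+ qX) (+ qY) (+ N) ⟩
      (+ rX ℤ.- + rY) ℤ.+ (+ qX ℤ.- + qY) ℤ.* + N   ∎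
      where
      open ≡-Reasoning
      shift : ∀ a y z → a ℤ.* z ≡ (y ℤ.+ z) ℤ.* a ℤ.- y ℤ.* a
      shift = ℤ-Solver.solve-∀
      cancel : ∀ rX rY h M qX qY N → (rX ℤ.+ h ℤ.* M ℤ.+ qX ℤ.* N) ℤ.- (rY ℤ.+ h ℤ.* M ℤ.+ qY ℤ.* N)
                                     ≡ (rX ℤ.- rY) ℤ.+ (qX ℤ.- qY) ℤ.* N
      cancel = ℤ-Solver.solve-∀

-- Double counting: by periodicity each of the `L` translates of `P` has as many elements in one
-- period as `P` itself, and every `u` lies in at most one translate.
∑-translates-disjoint : ∀ n L τ {P : ℕ → Set} (P? : ∀ u → Dec (P u)) →
  (∀ u → P (u + n) → P u) → (∀ u → P u → P (u + n)) →
  (∀ u i j → i < L → j < L → P (u + i * τ) → P (u + j * τ) → i ≡ j) →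
  L * ∑ n (λ u → indicator (P? u)) ≤ n
∑-translates-disjoint n L τ P? down up disjoint = begin
  L * ∑ n f                                ≡⟨ sym (∑-const L (∑ n f)) ⟩
  ∑ L (λ _ → ∑ n f)                        ≡⟨ ∑-cong L (λ i → sym (∑-periodic n f periodic (i * τ))) ⟩
  ∑ L (λ i → ∑ n (λ u → f (u + i * τ)))    ≡⟨ ∑-swap L n _ ⟩
  ∑ n (λ u → ∑ L (λ i → f (u + i * τ)))    ≤⟨ ∑-mono n (λ u _ → ∑-at-most-one L (λ i → P? (u + i * τ)) (disjoint u)) ⟩
  ∑ n (λ _ → 1)                            ≡⟨ trans (∑-const n 1) (*-identityʳ n) ⟩
  n                                        ∎
  where
  open ≤-Reasoning
  f : ℕ → ℕ
  f u = indicator (P? u)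
  periodic : ∀ u → f (u + n) ≡ f u
  periodic u = indicator-cong (P? (u + n)) (P? u) (down u) (up u)

absDiff-cases : ∀ x y → x ≢ y → Σ[ z ∈ ℕ ] (0 < z × z ≤ x ⊔ y × (x ≡ y + z ⊎ y ≡ x + z))
absDiff-cases x y x≢y with <-cmp x y
... | tri< x<y _ _ = y ∸ x , m<n⇒0<n∸m x<y , ≤-trans (m∸n≤m y x) (m≤n⊔m x y) , inj₂ (sym (m+[n∸m]≡n (<⇒≤ x<y)))
... | tri≈ _ x≡y _ = contradiction x≡y x≢y
... | tri> _ _ y<x = x ∸ y , m<n⇒0<n∸m y<x , ≤-trans (m∸n≤m x y) (m≤m⊔n x y) , inj₁ (sym (m+[n∸m]≡n (<⇒≤ y<x)))

-- The family is nearly universal because the multipliers 1 + 2 * u are odd: an even multiplier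
-- identifies words that differ in the top bit only.
module _ (v : ℕ) where

  private
    w = suc v
    H = 2 ^ v

  Collides : (l x y u : ℕ) → Set
  Collides l x y u = hash w l (1 + 2 * u) x ≡ hash w l (1 + 2 * u) y

  collides? : ∀ l x y u → Dec (Collides l x y u)
  collides? l x y u = hash w l (1 + 2 * u) x ≟ hash w l (1 + 2 * u) y

  hash-periodic′ : ∀ l x u → hash w l (1 + 2 * (u + H)) x ≡ hash w l (1 + 2 * u) x
  hash-periodic′ l x u = trans (cong (λ a → hash w l a x) (cong suc (*-distribˡ-+ 2 u H))) (hash-periodic w l (1 + 2 * u) x)

  -- With `z` the distance of `x` and `y`, a collision puts `a * z` into a window twice as wide as a
  -- bucket. Only half as many disjoint translates of it fit as there are buckets, which costs a
  -- factor 2 against ideal hashing. If the width of a bucket divides `z`, no odd multiplier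
  -- collides at all.
  multiplyShift-universal : ∀ l {x y} → x < 2 ^ w → y < 2 ^ w → x ≢ y →
                            2 ^ l * ∑ H (λ u → indicator (collides? l x y u)) ≤ 2 ^ w
  multiplyShift-universal zero {x} {y} _ _ _ = ≤-trans (≤-reflexive (*-identityˡ (∑ H f)))
    (≤-trans (∑-mono H (λ u _ → indicator≤1 (collides? 0 x y u)))
      (≤-trans (≤-reflexive (trans (∑-const H 1) (*-identityʳ H))) (m≤m+n H _)))
    where f = λ u → indicator (collides? 0 x y u)
  multiplyShift-universal (suc l) {x} {y} x< y< x≢y with absDiff-cases x y x≢y
  ... | z , 0<z , z≤ , cases with odd-part z 0<z
  ... | k , ζ , z≡ , odd with dichotomy
    where
    -- If `l > v`, the hash keeps all `w` bits: buckets have width 1, which divides `z`, so the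
    -- second case applies.
    dichotomy : (l ≤ v × k ≤ v ∸ l) ⊎ v ∸ l ≤ k
    dichotomy with l ≤? v | ≤-total k (v ∸ l)
    ... | yes l≤v | inj₁ k≤ = inj₁ (l≤v , k≤)
    ... | _       | inj₂ ≤k = inj₂ ≤k
    ... | no l≰v  | inj₁ _  = inj₂ (≤-trans (≤-reflexive (m≤n⇒m∸n≡0 (≰⇒≥ l≰v))) z≤n)
  ... | inj₁ (l≤v , k≤) = begin
      2 * 2 ^ l * ∑ H f     ≡⟨ *-assoc 2 (2 ^ l) (∑ H f) ⟩
      2 * (2 ^ l * ∑ H f)   ≤⟨ *-monoʳ-≤ 2 (∑-translates-disjoint H (2 ^ l) τ (collides? (suc l) x y)
                                 (λ u e → trans (sym (hash-periodic′ (suc l) x u)) (trans e (hash-periodic′ (suc l) y u)))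
                                 (λ u e → trans (hash-periodic′ (suc l) x u) (trans e (sym (hash-periodic′ (suc l) y u))))
                                 disjoint) ⟩
      2 * H                 ∎
    where
    open ≤-Reasoning
    f = λ u → indicator (collides? (suc l) x y u)
    M = 2 ^ (v ∸ l)
    -- Chosen so that `τ * z` is `M * ζ`, an odd multiple of half the width of the window.
    τ = 2 ^ (v ∸ l ∸ k)
    N≡ : 2 ^ w ≡ 2 * M * 2 ^ l
    N≡ = trans (cong (2 *_) (trans (cong (2 ^_) (sym (m∸n+n≡m l≤v))) (^-distribˡ-+-* 2 (v ∸ l) l))) (sym (*-assoc 2 M (2 ^ l)))
    Mζ≡τz : M * ζ ≡ τ * z
    Mζ≡τz = trans (cong (_* ζ) (trans (cong (2 ^_) (sym (m∸n+n≡m k≤))) (^-distribˡ-+-* 2 (v ∸ l ∸ k) k)))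
                  (trans (*-assoc τ (2 ^ k) ζ) (cong (τ *_) (sym z≡)))
    near : ∀ u → Collides (suc l) x y u → Near M (2 * M * 2 ^ l) (1 + 2 * u) z
    near u e = subst (λ N → Near M N (1 + 2 * u) z) N≡
      ([ (λ x≡ → collision⇒near w (suc l) (1 + 2 * u) x≡ e) , (λ y≡ → collision⇒near w (suc l) (1 + 2 * u) y≡ (sym e)) ]′ cases)
    disjoint : ∀ u i j → i < 2 ^ l → j < 2 ^ l → Collides (suc l) x y (u + i * τ) → Collides (suc l) x y (u + j * τ) → i ≡ j
    disjoint u i j i< j< ci cj = near-translates {M} {τ} {z} {ζ} {u} l Mζ≡τz odd i< j< (near (u + i * τ) ci) (near (u + j * τ) cj)
  ... | inj₂ r≤k = ≤-trans (≤-reflexive (trans (cong (2 ^ suc l *_) (∑-zero H _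
                      (λ u _ → indicator-no (collides? (suc l) x y u) (no-collision u))))
                      (*-zeroʳ (2 ^ suc l)))) z≤n
    where
    no-collision : ∀ u → ¬ Collides (suc l) x y u
    no-collision u e = near-multiple (v ∸ l) (1+2n-odd u) 0<z (≤-<-trans z≤ (⊔-lub x< y<)) z≡ r≤k (≤-trans (m∸n≤m v l) (n≤1+n v))
      ([ (λ x≡ → collision⇒near w (suc l) (1 + 2 * u) x≡ e) , (λ y≡ → collision⇒near w (suc l) (1 + 2 * u) y≡ (sym e)) ]′ cases)

  collisions : (l a : ℕ) → List (Fin (2 ^ w)) → ℕ
  collisions l a K = ∑₂ K (λ x y → indicator (hash w l a (toℕ x) ≟ hash w l a (toℕ y)))

  -- Linearity of expectation over the `2 ^ v` odd multipliers, then averaging. The factor 2 is the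
  -- loss in `multiplyShift-universal`.
  few-collisions : ∀ l {K : List (Fin (2 ^ w))} → Unique K → ∃[ a ] 2 ^ l * collisions l a K ≤ 2 * #pairs K
  few-collisions l {K} uq with ∑-minimum H {{m^n≢0 2 v}} (λ u → 2 ^ l * collisions l (1 + 2 * u) K) (2 * #pairs K) average
    where
    open ≤-Reasoning
    average : ∑ H (λ u → 2 ^ l * collisions l (1 + 2 * u) K) ≤ H * (2 * #pairs K)
    average = begin
      ∑ H (λ u → 2 ^ l * collisions l (1 + 2 * u) K)
        ≡⟨ ∑-distrib-* H (2 ^ l) _ ⟩
      2 ^ l * ∑ H (λ u → collisions l (1 + 2 * u) K)
        ≡⟨ cong (2 ^ l *_) (∑-∑₂-swap H K _) ⟩
      2 ^ l * ∑₂ K (λ x y → ∑ H (λ u → indicator (collides? l (toℕ x) (toℕ y) u)))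
        ≡⟨ sym (∑₂-distrib-* K (2 ^ l) _) ⟩
      ∑₂ K (λ x y → 2 ^ l * ∑ H (λ u → indicator (collides? l (toℕ x) (toℕ y) u)))
        ≤⟨ ∑₂-mono uq (λ {x} {y} x≢y → ≤-trans
             (multiplyShift-universal l (Fin.toℕ<n x) (Fin.toℕ<n y) (λ e → x≢y (Fin.toℕ-injective e)))
             (≤-reflexive (sym (*-identityʳ (2 ^ w))))) ⟩
      ∑₂ K (λ _ _ → 2 ^ w * 1)
        ≡⟨ ∑₂-distrib-* K (2 ^ w) _ ⟩
      2 ^ w * #pairs K
        ≡⟨ rearrange H (#pairs K) ⟩
      H * (2 * #pairs K) ∎
      where
      rearrange : ∀ h p → 2 * h * p ≡ h * (2 * p)
      rearrange = solve-∀
  ... | u , le = 1 + 2 * u , le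

  power-of-2-above : ∀ x → ∃[ l ] (x < 2 ^ l × 2 ^ l ≤ 1 + 2 * x)
  power-of-2-above zero = 0 , ≤-refl , ≤-refl
  power-of-2-above (suc x) with power-of-2-above x
  ... | l , x< , ≤2x with suc x <? 2 ^ l
  ...   | yes 1+x< = l , 1+x< , ≤-trans ≤2x (s≤s (*-monoʳ-≤ 2 (n≤1+n x)))
  ...   | no 1+x≮  = suc l , <-≤-trans (m<m*n (suc x) 2 ≤-refl) (≤-trans (*-monoˡ-≤ 2 x<) (≤-reflexive (*-comm (2 ^ l) 2))) ,
                     ≤-trans (*-monoʳ-≤ 2 (≮⇒≥ 1+x≮)) (n≤1+n _)

  opaque
    -- With more than `2 * #pairs K` buckets a suitable multiplier has fewer than one collision,
    -- hence none. Such a table is quadratic in the number of keys, which is affordable only at the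
    -- second level.
    perfect-hashing : ∀ {K : List (Fin (2 ^ w))} → Unique K → ∃[ a ] ∃[ l ] (2 ^ l ≤ 1 + 4 * #pairs K ×
      (∀ {x y} → x ∈ K → y ∈ K → hash w l a (toℕ x) ≡ hash w l a (toℕ y) → x ≡ y))
    perfect-hashing {K} uq with power-of-2-above (2 * #pairs K)
    ... | l , p< , ≤p with few-collisions l uq
    ... | a , few = a , l , ≤-trans ≤p (≤-reflexive (cong suc (sym (*-assoc 2 2 (#pairs K))))) , injective
      where
      F : Fin (2 ^ w) → Fin (2 ^ w) → ℕ
      F x y = indicator (hash w l a (toℕ x) ≟ hash w l a (toℕ y))
      F-sym : ∀ x y → F x y ≡ F y x
      F-sym x y = indicator-cong (hash w l a (toℕ x) ≟ hash w l a (toℕ y)) (hash w l a (toℕ y) ≟ hash w l a (toℕ x)) sym sym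
      none : collisions l a K < 1
      none = *-cancelˡ-< (2 ^ l) _ 1 (≤-<-trans few (<-≤-trans p< (≤-reflexive (sym (*-identityʳ (2 ^ l))))))
      injective : ∀ {x y} → x ∈ K → y ∈ K → hash w l a (toℕ x) ≡ hash w l a (toℕ y) → x ≡ y
      injective {x} {y} x∈ y∈ e with x Fin.≟ y
      ... | yes x≡y = x≡y
      ... | no x≢y = contradiction (≤-trans (≤-reflexive (sym (indicator-yes (hash w l a (toℕ x) ≟ hash w l a (toℕ y)) e)))
                                            (∑₂-term-≤ K F F-sym x∈ y∈ x≢y)) (<⇒≱ none)

    -- `2 * #pairs K` is at most the square of the number of keys, and there are more buckets than
    -- keys; dividing leaves at most one collision per key.
    linear-hashing : ∀ {K : List (Fin (2 ^ w))} → Unique K → ∃[ a ] ∃[ l ] (2 ^ l ≤ 1 + 2 * length K × collisions l a K ≤ length K)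
    linear-hashing {K} uq with power-of-2-above (length K)
    ... | l , k< , ≤k with few-collisions l uq
    ... | a , few = a , l , ≤k , *-cancelˡ-≤ (2 ^ l) {{m^n≢0 2 l}} (≤-trans few (≤-trans (#pairs-bound K) (*-monoˡ-≤ (length K) (<⇒≤ k<))))

-- Hash tables as trie nodes

module _ {A : Set} (key : A → ℕ) where

  bucket : List A → ℕ → List A
  bucket K i = filter (λ x → key x ≟ i) K

  ∑-buckets : ∀ n K (h : A → ℕ) → (∀ x → key x < n) → ∑ n (λ i → ∑ₗ (bucket K i) h) ≡ ∑ₗ K h
  ∑-buckets n K h key<n = begin
    ∑ n (λ i → ∑ₗ (bucket K i) h)                               ≡⟨ ∑-cong n (λ i → ∑ₗ-filter (λ x → key x ≟ i) K h) ⟩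
    ∑ n (λ i → ∑ₗ K (λ x → indicator (key x ≟ i) * h x))        ≡⟨ ∑-∑ₗ-swap n K _ ⟩
    ∑ₗ K (λ x → ∑ n (λ i → indicator (key x ≟ i) * h x))        ≡⟨ ∑ₗ-cong K (λ {x} _ → ∑-pointMass n (λ _ → h x) (key<n x)) ⟩
    ∑ₗ K h                                                      ∎
    where open ≡-Reasoning

  -- A pair shares a bucket exactly when it collides, so the collisions at the first level measure
  -- the total size of the quadratic tables at the second.
  ∑-#pairs-buckets : ∀ n K → (∀ x → key x < n) →
                     ∑ n (λ i → #pairs (bucket K i)) ≡ ∑₂ K (λ x y → indicator (key x ≟ key y))
  ∑-#pairs-buckets n K key<n = begin
    ∑ n (λ i → #pairs (bucket K i))                                                    ≡⟨ ∑-cong n (λ i → #pairs-filter (λ x → key x ≟ i) K) ⟩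
    ∑ n (λ i → ∑₂ K (λ x y → indicator (key x ≟ i) * indicator (key y ≟ i)))           ≡⟨ ∑-∑₂-swap n K _ ⟩
    ∑₂ K (λ x y → ∑ n (λ i → indicator (key x ≟ i) * indicator (key y ≟ i)))           ≡⟨ ∑₂-cong K (λ x y → ∑-pointMass n (λ i → indicator (key y ≟ i)) (key<n x)) ⟩
    ∑₂ K (λ x y → indicator (key y ≟ key x))                                           ≡⟨ ∑₂-cong K (λ x y → indicator-cong (key y ≟ key x) (key x ≟ key y) sym sym) ⟩
    ∑₂ K (λ x y → indicator (key x ≟ key y))                                           ∎
    where open ≡-Reasoning

-- A blind (Patricia) trie: q is the pattern position tested at a node, rep one of the occurrences
-- below it, and ans the answer to patterns of length at most q that occur at rep.
data Tree (w : ℕ) : Set where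
  fail : Tree w
  node : (q rep : ℕ) (ans : RAM.Word w) (a l : ℕ) (child : ℕ → Tree w) → Tree w

-- Words occupied in memory: five header words and one pointer per bucket, or the three words of a
-- leaf. Subtrees are not shared; every bucket is charged for its own.
size : ∀ {w} → Tree w → ℕ
size fail                         = 3
size (node q rep ans a l child) = 5 + 2 ^ l + ∑ (2 ^ l) (λ i → size (child i))

-- The descent without machine details. The bound `q ≤ n` in `halt` ensures that the stored `q` is
-- read back unreduced; in `descend` the bound `q < m` does the same.
data Walk {w : ℕ} (n m : ℕ) (px : ℕ → RAM.Word w) : Tree w → (steps rep : ℕ) (ans : RAM.Word w) → Set where
  halt-fail : Walk n m px fail 0 0 (RAM.word w 0)
  halt      : ∀ {q rep ans a l child} → m ≤ q → q ≤ n → Walk n m px (node q rep ans a l child) 0 rep ans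
  descend   : ∀ {q rep ans a l child k rep′ ans′} → q < m →
              Walk n m px (child (hash w l a (toℕ (px q)))) k rep′ ans′ →
              Walk n m px (node q rep ans a l child) (suc k) rep′ ans′

module _ {v : ℕ} where

  private
    w = suc v
    Word = RAM.Word w

  -- Keys outside K may be sent to the subtree of any other key, since a query verifies its match at the end.
  Selects : List Word → (Word → Tree w) → Word → Tree w → Set
  Selects K g c t = (c ∈ K → t ≡ g c) × (t ≡ fail ⊎ ∃[ c′ ] (c′ ∈ K × t ≡ g c′))

  LeadsTo : (q d : ℕ) (c : Word) (t t′ : Tree w) → Set
  LeadsTo q d c t t′ = ∀ {n m px k rep ans} → q < m → px q ≡ c → Walk n m px t′ k rep ans → Walk n m px t (d + k) rep ans

  -- Meant for the buckets of a hash function that is injective on distinct keys: they hold at most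
  -- one key, so taking the first loses nothing.
  firstOrFail : (Word → Tree w) → List Word → Tree w
  firstOrFail g []      = fail
  firstOrFail g (c ∷ _) = g c

  size-firstOrFail : ∀ g K → size (firstOrFail g K) ≤ 3 + ∑ₗ K (λ c → size (g c))
  size-firstOrFail g []      = ≤-refl
  size-firstOrFail g (c ∷ K) = ≤-trans (m≤m+n (size (g c)) _) (m≤n+m _ 3)

  firstOrFail-selects : ∀ g (h : Word → ℕ) K c → (∀ {x y} → x ∈ K → y ∈ K → h x ≡ h y → x ≡ y) →
                        Selects K g c (firstOrFail g (bucket h K (h c)))
  firstOrFail-selects g h K c injective with bucket h K (h c) in eqn
  ... | [] = (λ c∈K → contradiction (subst (c ∈_) eqn (∈-filter⁺ (λ x → h x ≟ h c) c∈K refl)) λ ()) , inj₁ refl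
  ... | c′ ∷ _ with ∈-filter⁻ (λ x → h x ≟ h c) {xs = K} (subst (c′ ∈_) (sym eqn) (here refl))
  ...   | c′∈K , h≡ = (λ c∈K → cong g (injective c′∈K c∈K h≡)) , inj₂ (c′ , c′∈K , refl)

  StopsAt : (q rep : ℕ) (ans : Word) → Tree w → Set
  StopsAt q rep ans t = ∀ {n m px} → m ≤ q → q ≤ n → Walk n m px t 0 rep ans

  opaque
    -- Each of the at most `1 + 4 * #pairs K` buckets costs up to four words, its pointer and a
    -- three-word leaf; the subtrees are charged to their keys.
    perfect-node : ∀ (q rep : ℕ) (ans : Word) (g : Word → Tree w) {K : List Word} → Unique K →
      Σ[ t ∈ Tree w ] (size t ≤ 9 + 16 * #pairs K + ∑ₗ K (λ c → size (g c)) ×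
        (∀ c → ∃[ t′ ] (Selects K g c t′ × LeadsTo q 1 c t t′)))
    perfect-node q rep ans g {K} uq with perfect-hashing v uq
    ... | a , l , 2^l≤ , injective = node q rep ans a l child , bound ,
          λ c → child (h c) , firstOrFail-selects g h K c injective , λ { q<m refl walk → descend q<m walk }
      where
      h : Word → ℕ
      h c = hash w l a (toℕ c)
      child : ℕ → Tree w
      child i = firstOrFail g (bucket h K i)
      X : ℕ
      X = ∑ₗ K (λ c → size (g c))
      open ≤-Reasoning
      bound : 5 + 2 ^ l + ∑ (2 ^ l) (λ i → size (child i)) ≤ 9 + 16 * #pairs K + X
      bound = begin
        5 + 2 ^ l + ∑ (2 ^ l) (λ i → size (child i))
          ≤⟨ +-monoʳ-≤ (5 + 2 ^ l) (∑-mono (2 ^ l) (λ i _ → size-firstOrFail g (bucket h K i))) ⟩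
        5 + 2 ^ l + ∑ (2 ^ l) (λ i → 3 + ∑ₗ (bucket h K i) (λ c → size (g c)))
          ≡⟨ cong (5 + 2 ^ l +_) (trans (∑-distrib-+ (2 ^ l) (λ _ → 3) _)
               (cong₂ _+_ (∑-const (2 ^ l) 3) (∑-buckets h (2 ^ l) K _ (λ c → hash<2^l w l a (toℕ c))))) ⟩
        5 + 2 ^ l + (2 ^ l * 3 + X)
          ≡⟨ collect (2 ^ l) X ⟩
        5 + 4 * 2 ^ l + X
          ≤⟨ +-monoˡ-≤ X (+-monoʳ-≤ 5 (*-monoʳ-≤ 4 2^l≤)) ⟩
        5 + 4 * (1 + 4 * #pairs K) + X
          ≡⟨ expand (#pairs K) X ⟩
        9 + 16 * #pairs K + X ∎
        where
        collect : ∀ L X → 5 + L + (L * 3 + X) ≡ 5 + 4 * L + X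
        collect = solve-∀
        expand : ∀ p X → 5 + 4 * (1 + 4 * p) + X ≡ 9 + 16 * p + X
        expand = solve-∀

  -- The two-level scheme of Fredman, Komlós and Szemerédi.
  opaque
    dictionary-node : ∀ (q rep : ℕ) (ans : Word) (g : Word → Tree w) {K : List Word} → Unique K →
      Σ[ t ∈ Tree w ] (size t ≤ 15 + 36 * length K + ∑ₗ K (λ c → size (g c)) × StopsAt q rep ans t ×
        (∀ c → ∃[ t′ ] (Selects K g c t′ × LeadsTo q 2 c t t′)))
    dictionary-node q rep ans g {K} uq with linear-hashing v uq
    ... | a , l , 2^l≤ , coll≤ = node q rep ans a l child , bound , halt , lookup
      where
      h : Word → ℕ
      h c = hash w l a (toℕ c)
      second : ∀ i → Σ[ t ∈ Tree w ] (size t ≤ 9 + 16 * #pairs (bucket h K i) + ∑ₗ (bucket h K i) (λ c → size (g c)) ×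
                 (∀ c → ∃[ t′ ] (Selects (bucket h K i) g c t′ × LeadsTo q 1 c t t′)))
      second i = perfect-node q rep ans g (Unique.filter⁺ (λ x → h x ≟ i) uq)
      child : ℕ → Tree w
      child i = proj₁ (second i)
      X : ℕ
      X = ∑ₗ K (λ c → size (g c))
      k : ℕ
      k = length K
      lookup : ∀ c → ∃[ t′ ] (Selects K g c t′ × LeadsTo q 2 c (node q rep ans a l child) t′)
      lookup c = let t′ , (hit , range) , leads = proj₂ (proj₂ (second (h c))) c in
            t′ ,
            ((λ c∈K → hit (∈-filter⁺ (λ x → h x ≟ h c) c∈K refl)) ,
             [ inj₁ , (λ { (c′ , c′∈ , t′≡) → inj₂ (c′ , proj₁ (∈-filter⁻ (λ x → h x ≟ h c) c′∈) , t′≡) }) ]′ range) ,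
            λ { q<m refl walk → descend q<m (leads q<m refl walk) }
      open ≤-Reasoning
      bound : 5 + 2 ^ l + ∑ (2 ^ l) (λ i → size (child i)) ≤ 15 + 36 * k + X
      bound = begin
        5 + 2 ^ l + ∑ (2 ^ l) (λ i → size (child i))
          ≤⟨ +-monoʳ-≤ (5 + 2 ^ l) (∑-mono (2 ^ l) (λ i _ → proj₁ (proj₂ (second i)))) ⟩
        5 + 2 ^ l + ∑ (2 ^ l) (λ i → 9 + 16 * #pairs (bucket h K i) + ∑ₗ (bucket h K i) (λ c → size (g c)))
          -- Summed over the buckets, the pairs inside them are the collisions of `K`, so the
          -- quadratic terms add up to a linear one.
          ≡⟨ cong (5 + 2 ^ l +_) (trans (∑-distrib-+ (2 ^ l) (λ i → 9 + 16 * #pairs (bucket h K i)) _)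
               (cong₂ _+_ (trans (∑-distrib-+ (2 ^ l) (λ _ → 9) _)
                            (cong₂ _+_ (∑-const (2 ^ l) 9)
                              (trans (∑-distrib-* (2 ^ l) 16 _) (cong (16 *_) (∑-#pairs-buckets h (2 ^ l) K h<)))))
                          (∑-buckets h (2 ^ l) K _ h<))) ⟩
        5 + 2 ^ l + (2 ^ l * 9 + 16 * collisions v l a K + X)
          ≡⟨ collect (2 ^ l) (collisions v l a K) X ⟩
        5 + 10 * 2 ^ l + 16 * collisions v l a K + X
          ≤⟨ +-monoˡ-≤ X (+-mono-≤ (+-monoʳ-≤ 5 (*-monoʳ-≤ 10 2^l≤)) (*-monoʳ-≤ 16 coll≤)) ⟩
        5 + 10 * (1 + 2 * k) + 16 * k + X
          ≡⟨ expand k X ⟩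
        15 + 36 * k + X ∎
        where
        h< : ∀ c → h c < 2 ^ l
        h< c = hash<2^l w l a (toℕ c)
        collect : ∀ L c X → 5 + L + (L * 9 + 16 * c + X) ≡ 5 + 10 * L + 16 * c + X
        collect = solve-∀
        expand : ∀ k X → 5 + 10 * (1 + 2 * k) + 16 * k + X ≡ 15 + 36 * k + X
        expand = solve-∀

-- The compacted trie: space and correctness

two-members : {A : Set} {xs : List A} {x y : A} → x ∈ xs → y ∈ xs → x ≢ y → 2 ≤ length xs
two-members {xs = _ ∷ []}    (here refl) (here refl) x≢y = contradiction refl x≢y
two-members {xs = _ ∷ _ ∷ _} _           _           _   = s≤s (s≤s z≤n)

module Trie (v n : ℕ) (text : ℕ → RAM.Word (suc v)) (answer : List ℕ → RAM.Word (suc v)) where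

  private
    w = suc v
    Word = RAM.Word w

  Match : (m : ℕ) (px : ℕ → Word) (i : ℕ) → Set
  Match m px i = i + m ≤ n × (∀ j → j < m → text (i + j) ≡ px j)

  -- What the final comparison relies on: `rep + m ≤ n` keeps it inside the text even for a pattern
  -- led astray. If it succeeds, `ans` belongs to the exact set of occurrences; if it fails, the
  -- last component excludes all occurrences.
  Outcome : (m : ℕ) (px : ℕ → Word) (rep : ℕ) (ans : Word) → Set
  Outcome m px rep ans =
    rep + m ≤ n ×
    (Match m px rep → Σ[ S ∈ List ℕ ] (ans ≡ answer S × (∀ i → Match m px i → i ∈ S) × (∀ i → i ∈ S → Match m px i))) ×
    (∀ i → Match m px i → Match m px rep)

  -- The hypothesis holds vacuously for patterns that do not occur, which may be led into any subtree.
  Correct : (q : ℕ) (S : List ℕ) (t : Tree w) → Set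
  Correct q S t = ∀ m px → m ≤ n → (∀ i → Match m px i → i ∈ S) →
    ∃[ k ] ∃[ rep ] ∃[ ans ] (Walk n m px t k rep ans × k ≤ 2 * (m ∸ q) × Outcome m px rep ans)

  -- The slack 87 makes up for the 15 + 36 k words of a node with k ≥ 2 children, since 15 + 36 k + 87 ≤ 87 k.
  Good : (q : ℕ) (S : List ℕ) (t : Tree w) → Set
  Good q S t = size t + 87 ≤ 102 * length S × Correct q S t

  module Branch (q s : ℕ) (S : List ℕ) (s∈S : s ∈ S) (fits : ∀ {i} → i ∈ S → i + q ≤ n)
                (agree : ∀ {i} → i ∈ S → ∀ j → j < q → text (i + j) ≡ text (s + j)) where

    fits? : ∀ i → Dec (i + q < n)
    fits? i = i + q <? n

    E : List ℕ
    E = filter fits? S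

    nextChars : List Word
    nextChars = deduplicate Fin._≟_ (map (λ i → text (i + q)) E)

    class : Word → List ℕ
    class c = filter (λ i → text (i + q) Fin.≟ c) E

    E⊆S : ∀ {i} → i ∈ E → i ∈ S × i + q < n
    E⊆S = ∈-filter⁻ fits? {xs = S}

    nextChar∈ : ∀ {i} → i ∈ E → text (i + q) ∈ nextChars
    nextChar∈ i∈E = ∈-deduplicate⁺ Fin._≟_ (∈-map⁺ (λ i → text (i + q)) i∈E)

    class-inhabited : ∀ {c} → c ∈ nextChars → ∃[ i ] i ∈ class c
    class-inhabited {c} c∈ with ∈-map⁻ (λ i → text (i + q)) (∈-deduplicate⁻ Fin._≟_ (map (λ i → text (i + q)) E) c∈)
    ... | i , i∈E , c≡ = i , ∈-filter⁺ (λ i → text (i + q) Fin.≟ c) i∈E (sym c≡)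

    ∑-class : ∑ₗ nextChars (λ c → length (class c)) ≤ length E
    ∑-class = begin
      ∑ₗ nextChars (λ c → length (class c))
        ≡⟨ ∑ₗ-cong nextChars (λ {c} _ → length-filter-∑ₗ (λ i → text (i + q) Fin.≟ c) E) ⟩
      ∑ₗ nextChars (λ c → ∑ₗ E (λ i → indicator (text (i + q) Fin.≟ c)))
        ≡⟨ ∑ₗ-swap nextChars E _ ⟩
      ∑ₗ E (λ i → ∑ₗ nextChars (λ c → indicator (text (i + q) Fin.≟ c)))
        ≤⟨ ∑ₗ-mono E (λ {i} _ → ∑ₗ-unique (λ c → text (i + q) Fin.≟ c)
             (deduplicate-! Fin._≟_ (map (λ i → text (i + q)) E)) (λ c≡ c′≡ → trans (sym c≡) c′≡)) ⟩
      ∑ₗ E (λ _ → 1)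
        ≡⟨ trans (∑ₗ-const E 1) (*-identityʳ (length E)) ⟩
      length E ∎
      where open ≤-Reasoning

    module _ (subtrie : ∀ c → Σ[ t ∈ Tree w ] (c ∈ nextChars → Good (suc q) (class c) t))
             (split : ¬ All (λ i → i + q < n × text (i + q) ≡ text (s + q)) S) where

      -- No end marker is appended to the text, so a suffix may end where others go on. A node is
      -- thus justified either by a position that drops out or by a second child, and each
      -- alternative pays for it in its own way.
      shrinks-or-branches : suc (length E) ≤ length S ⊎ 2 ≤ length nextChars
      shrinks-or-branches with find (¬All⇒Any¬ (λ i → fits? i ×-dec (text (i + q) Fin.≟ text (s + q))) S split)
      ... | i , i∈S , differs with fits? i | fits? s
      ... | no i-ends | _         = inj₁ (filter-notAll fits? S (lose i∈S i-ends))
      ... | yes _     | no s-ends = inj₁ (filter-notAll fits? S (lose s∈S s-ends))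
      ... | yes i+q<n | yes s+q<n = inj₂ (two-members (nextChar∈ (∈-filter⁺ fits? i∈S i+q<n)) (nextChar∈ (∈-filter⁺ fits? s∈S s+q<n))
                                                      (λ same → differs (i+q<n , same)))

      subtree : Word → Tree w
      subtree c = proj₁ (subtrie c)

      dict : Σ[ t ∈ Tree w ] (size t ≤ 15 + 36 * length nextChars + ∑ₗ nextChars (λ c → size (subtree c)) ×
               StopsAt q s (answer S) t × (∀ c → ∃[ t′ ] (Selects nextChars subtree c t′ × LeadsTo q 2 c t t′)))
      dict = dictionary-node q s (answer S) subtree (deduplicate-! Fin._≟_ (map (λ i → text (i + q)) E))

      t : Tree w
      t = proj₁ dict

      bound : size t + 87 ≤ 102 * length S
      bound = begin
        size t + 87                ≤⟨ +-monoˡ-≤ 87 (proj₁ (proj₂ dict)) ⟩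
        15 + 36 * k + X + 87       ≡⟨ rearrange k X ⟩
        102 + 36 * k + X           ≤⟨ [ shrinks , branches ]′ shrinks-or-branches ⟩
        102 * length S             ∎
        where
        open ≤-Reasoning
        k X : ℕ
        k = length nextChars
        X = ∑ₗ nextChars (λ c → size (subtree c))
        rearrange : ∀ k X → 15 + 36 * k + X + 87 ≡ 102 + 36 * k + X
        rearrange = solve-∀
        subtrees : X + k * 87 ≤ 102 * length E
        subtrees = begin
          X + k * 87                                        ≡⟨ cong (X +_) (sym (∑ₗ-const nextChars 87)) ⟩
          X + ∑ₗ nextChars (λ _ → 87)                       ≡⟨ sym (∑ₗ-distrib-+ nextChars (λ c → size (subtree c)) (λ _ → 87)) ⟩
          ∑ₗ nextChars (λ c → size (subtree c) + 87)        ≤⟨ ∑ₗ-mono nextChars (λ {c} c∈ → proj₁ (proj₂ (subtrie c) c∈)) ⟩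
          ∑ₗ nextChars (λ c → 102 * length (class c))       ≡⟨ ∑ₗ-distrib-* nextChars 102 (λ c → length (class c)) ⟩
          102 * ∑ₗ nextChars (λ c → length (class c))       ≤⟨ *-monoʳ-≤ 102 ∑-class ⟩
          102 * length E                                    ∎
        -- The position that drops out pays the 102, and the slack 87 of each child covers its 36
        -- words.
        shrinks : suc (length E) ≤ length S → 102 + 36 * k + X ≤ 102 * length S
        shrinks E<S = begin
          102 + 36 * k + X            ≤⟨ +-monoˡ-≤ X (+-monoʳ-≤ 102 (*-monoˡ-≤ k (m≤m+n 36 51))) ⟩
          102 + 87 * k + X            ≡⟨ swap k X ⟩
          102 + (X + k * 87)          ≤⟨ +-monoʳ-≤ 102 subtrees ⟩
          102 + 102 * length E        ≡⟨ sym (*-suc 102 (length E)) ⟩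
          102 * suc (length E)        ≤⟨ *-monoʳ-≤ 102 E<S ⟩
          102 * length S              ∎
          where swap : ∀ k X → 102 + 87 * k + X ≡ 102 + (X + k * 87)
                swap = solve-∀
        -- Here nothing has to drop out: two children give `102 ≤ 51 * k`, and 51 + 36 is exactly
        -- the slack 87 of a child.
        branches : 2 ≤ k → 102 + 36 * k + X ≤ 102 * length S
        branches 2≤k = begin
          102 + 36 * k + X            ≤⟨ +-monoˡ-≤ X (+-monoˡ-≤ (36 * k) (*-monoʳ-≤ 51 2≤k)) ⟩
          51 * k + 36 * k + X         ≡⟨ swap k X ⟩
          X + k * 87                  ≤⟨ subtrees ⟩
          102 * length E              ≤⟨ *-monoʳ-≤ 102 (length-filter fits? S) ⟩
          102 * length S              ∎
          where swap : ∀ k X → 51 * k + 36 * k + X ≡ X + k * 87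
                swap = solve-∀

      agree-match : ∀ {m px i j} → m ≤ q → i ∈ S → j ∈ S → Match m px i → Match m px j
      agree-match m≤q i∈S j∈S (_ , match) = ≤-trans (+-monoʳ-≤ _ m≤q) (fits j∈S) ,
        λ p p<m → trans (trans (agree j∈S p (<-≤-trans p<m m≤q)) (sym (agree i∈S p (<-≤-trans p<m m≤q)))) (match p p<m)

      correct : Correct q S t
      correct m px m≤n ⊆S with m ≤? q
      ... | yes m≤q = 0 , s , answer S , proj₁ (proj₂ (proj₂ dict)) m≤q (≤-trans (m≤n+m q s) (fits s∈S)) , z≤n ,
            ≤-trans (+-monoʳ-≤ s m≤q) (fits s∈S) ,
            (λ match → S , refl , ⊆S , λ i i∈S → agree-match m≤q s∈S i∈S match) ,
            (λ i match → agree-match m≤q (⊆S i match) s∈S match)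
      ... | no m≰q = continue (proj₂ (proj₂ (proj₂ dict)) (px q))
        where
        q<m : q < m
        q<m = ≰⇒> m≰q
        match∈E : ∀ {i} → Match m px i → i ∈ E
        match∈E {i} match = ∈-filter⁺ fits? (⊆S i match) (<-≤-trans (+-monoʳ-< i q<m) (proj₁ match))
        match-char : ∀ {i} → Match m px i → text (i + q) ≡ px q
        match-char (_ , match) = match q q<m
        Result : Tree w → ℕ → Set
        Result t d = ∃[ k ] ∃[ rep ] ∃[ ans ] (Walk n m px t k rep ans × k ≤ d × Outcome m px rep ans)
        steps : ∀ {k} → k ≤ 2 * (m ∸ suc q) → 2 + k ≤ 2 * (m ∸ q)
        steps k≤ = ≤-trans (+-monoʳ-≤ 2 k≤) (≤-reflexive (trans (sym (*-suc 2 (m ∸ suc q))) (cong (2 *_) (sym (+-∸-assoc 1 q<m)))))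
        via : ∀ {t′} → LeadsTo q 2 (px q) t t′ → Result t′ (2 * (m ∸ suc q)) → Result t (2 * (m ∸ q))
        via leads (k , rep , ans , walk , k≤ , outcome) = 2 + k , rep , ans , leads q<m refl walk , steps k≤ , outcome
        continue : ∃[ t′ ] (Selects nextChars subtree (px q) t′ × LeadsTo q 2 (px q) t t′) → Result t (2 * (m ∸ q))
        continue (t′ , (hit , range) , leads) with DecMembership._∈?_ Fin._≟_ (px q) nextChars
        ... | yes c∈ = via leads (subst (λ t → Result t (2 * (m ∸ suc q))) (sym (hit c∈))
                (proj₂ (proj₂ (subtrie (px q)) c∈) m px m≤n
                  (λ i match → ∈-filter⁺ (λ i → text (i + q) Fin.≟ px q) (match∈E match) (match-char match))))
        -- No position of `S` is followed by this character, so the pattern does not occur and any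
        -- subtree will do: only `rep + m ≤ n` and the step bound still have content.
        ... | no c∉ = via leads (elsewhere range)
          where
          none : ∀ i → ¬ Match m px i
          none i match = c∉ (subst (_∈ nextChars) (match-char match) (nextChar∈ (match∈E match)))
          elsewhere : ∀ {t′} → t′ ≡ fail ⊎ ∃[ c′ ] (c′ ∈ nextChars × t′ ≡ subtree c′) → Result t′ (2 * (m ∸ suc q))
          elsewhere (inj₁ refl) = 0 , 0 , RAM.word w 0 , halt-fail , z≤n , m≤n ,
            (λ match → contradiction match (none 0)) , (λ i match → contradiction match (none i))
          elsewhere (inj₂ (c′ , c′∈ , refl)) = proj₂ (proj₂ (subtrie c′) c′∈) m px m≤n (λ i match → contradiction match (none i))

  -- `fuel` is the depth left, since `S` may stay the same while `q` grows. It cannot run out,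
  -- because `s + q ≤ n < q + fuel`.
  trie : ∀ fuel q s S → n < q + fuel → s ∈ S → (∀ {i} → i ∈ S → i + q ≤ n) →
         (∀ {i} → i ∈ S → ∀ j → j < q → text (i + j) ≡ text (s + j)) → ∃[ t ] Good q S t
  trie zero q s S n<q s∈S fits agree =
    contradiction (≤-trans (m≤n+m q s) (fits s∈S)) (<⇒≱ (subst (n <_) (+-identityʳ q) n<q))
  trie (suc fuel) q s S n< s∈S fits agree = cases (All.all? (λ i → (i + q <? n) ×-dec (text (i + q) Fin.≟ text (s + q))) S)
    where
    open Branch q s S s∈S fits agree
    n<′ : n < suc q + fuel
    n<′ = subst (n <_) (+-suc q fuel) n<

    extend-agreement : ∀ {S′ s′} → (∀ {i} → i ∈ S′ → i ∈ S × text (i + q) ≡ text (s′ + q)) → s′ ∈ S →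
                       ∀ {i} → i ∈ S′ → ∀ j → j < suc q → text (i + j) ≡ text (s′ + j)
    extend-agreement S′⊆ s′∈S {i} i∈ j j<1+q with j ≟ q
    ... | yes refl = proj₂ (S′⊆ i∈)
    ... | no j≢q   = trans (agree (proj₁ (S′⊆ i∈)) j j<q) (sym (agree s′∈S j j<q))
      where j<q = ≤∧≢⇒< (s≤s⁻¹ j<1+q) j≢q

    subtrie : ∀ c → Σ[ t ∈ Tree w ] (c ∈ nextChars → Good (suc q) (class c) t)
    subtrie c with DecMembership._∈?_ Fin._≟_ c nextChars
    ... | no c∉  = fail , λ c∈ → contradiction c∈ c∉
    ... | yes c∈ = let s′ , s′∈ = class-inhabited c∈
                       t , good = trie fuel (suc q) s′ (class c) n<′ s′∈
                                    (λ {i} i∈ → subst (_≤ n) (sym (+-suc i q)) (proj₂ (E⊆S (in-class i∈))))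
                                    (extend-agreement (λ i∈ → proj₁ (E⊆S (in-class i∈)) , trans (char i∈) (sym (char s′∈)))
                                                      (proj₁ (E⊆S (in-class s′∈))))
                   in t , λ _ → good
      where
      in-class : ∀ {i} → i ∈ class c → i ∈ E
      in-class i∈ = proj₁ (∈-filter⁻ (λ i → text (i + q) Fin.≟ c) i∈)
      char : ∀ {i} → i ∈ class c → text (i + q) ≡ c
      char i∈ = proj₂ (∈-filter⁻ (λ i → text (i + q) Fin.≟ c) {xs = E} i∈)

    cases : Dec (All (λ i → i + q < n × text (i + q) ≡ text (s + q)) S) → ∃[ t ] Good q S t
    cases (no split) = t subtrie split , bound subtrie split , correct subtrie split
    -- Path compression: all positions continue with the same character, so no node is made and the
    -- pattern position `q` is not tested.
    cases (yes same) =
      let t , small , correct = trie fuel (suc q) s S n<′ s∈S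
                                  (λ {i} i∈ → subst (_≤ n) (sym (+-suc i q)) (proj₁ (All.lookup same i∈)))
                                  (extend-agreement (λ i∈ → i∈ , proj₂ (All.lookup same i∈)) s∈S)
      in t , small , λ m px m≤n ⊆S →
        let k , rep , ans , walk , k≤ , outcome = correct m px m≤n ⊆S
        in k , rep , ans , walk , ≤-trans k≤ (*-monoʳ-≤ 2 (∸-monoʳ-≤ m (n≤1+n q))) , outcome

-- Word arithmetic and memory layout

module Words (w : ℕ) where

  open RAM w

  toℕ-word : ∀ x → toℕ (word x) ≡ x %2^ w
  toℕ-word x = Fin.toℕ-fromℕ< (m%n<n x (2 ^ w) {{m^n≢0 2 w}})

  toℕ-word-< : ∀ {x} → x < 2 ^ w → toℕ (word x) ≡ x
  toℕ-word-< {x} x< = trans (toℕ-word x) (m<n⇒m%n≡m {{m^n≢0 2 w}} x<)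

  record _≐_ (x : Word) (a : ℕ) : Set where
    constructor value
    field toℕ≡ : toℕ x ≡ a

  open _≐_ public

  eval-< : ∀ o {x y a b} → x ≐ a → y ≐ b → opℕ o a b < 2 ^ w → evalOp o x y ≐ opℕ o a b
  eval-< o (value refl) (value refl) o< = value (toℕ-word-< o<)

  -- Wrap-around is harmless: machine multiplication reduces modulo `2 ^ w` just as `hash` does, so
  -- the multiplier too may be stored reduced.
  eval-hash : ∀ l a {c r s} → toℕ r ≡ a %2^ w → s ≐ (w ∸ l) → evalOp shr (evalOp mul c r) s ≐ hash w l a (toℕ c)
  eval-hash l a {c} {r} {s} r≡ (value s≡) = value (trans (toℕ-word (quot (toℕ (evalOp mul c r)) (2 ^ toℕ s))) (trans
    (cong (_%2^ w) (trans (cong₂ (λ x y → quot x (2 ^ y)) product s≡) (quot-2^ ((toℕ c * a) %2^ w) (w ∸ l))))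
    (m<n⇒m%n≡m {{m^n≢0 2 w}} (≤-<-trans (hash≤ (toℕ c * a)) (m%n<n (toℕ c * a) (2 ^ w) {{m^n≢0 2 w}})))))
    where
    instance _ = m^n≢0 2 w
    hash≤ : ∀ x → (x %2^ w) /2^ (w ∸ l) ≤ x %2^ w
    hash≤ x = m/n≤m (x %2^ w) (2 ^ (w ∸ l)) {{m^n≢0 2 (w ∸ l)}}
    quot≡/ : ∀ x y .{{_ : NonZero y}} → quot x y ≡ x / y
    quot≡/ x (suc y) = refl
    quot-2^ : ∀ x k → quot x (2 ^ k) ≡ x /2^ k
    quot-2^ x k = quot≡/ x (2 ^ k) {{m^n≢0 2 k}}
    product : toℕ (evalOp mul c r) ≡ (toℕ c * a) %2^ w
    product = trans (toℕ-word (toℕ c * toℕ r)) (trans (cong (λ x → (toℕ c * x) %2^ w) r≡)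
      (trans (%-distribˡ-* (toℕ c) (a % 2 ^ w) (2 ^ w))
        (trans (cong (λ x → (toℕ c % 2 ^ w * x) % 2 ^ w) (m%n%n≡m%n a (2 ^ w)))
          (sym (%-distribˡ-* (toℕ c) a (2 ^ w))))))

  eval-decrement : ∀ {x y j} → 1 < 2 ^ w → x ≐ suc j → y ≐ 1 → evalOp sub x y ≐ j
  eval-decrement {x} {y} {j} 1< (value x≡) (value y≡) = value (trans (toℕ-word (toℕ x + (2 ^ w ∸ toℕ y)))
    (trans (cong₂ (λ a b → (a + (2 ^ w ∸ b)) %2^ w) x≡ y≡)
      (trans (cong (_%2^ w) (trans (sym (+-suc j (2 ^ w ∸ 1))) (cong (j +_) (m+[n∸m]≡n (<⇒≤ 1<)))))
        (trans ([m+n]%n≡m%n j (2 ^ w) {{m^n≢0 2 w}})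
          (m<n⇒m%n≡m {{m^n≢0 2 w}} (≤-trans (≤-reflexive (sym x≡)) (<⇒≤ (Fin.toℕ<n x))))))))

module Layout (w n : ℕ) where

  open RAM w

  Holds : (mem : ℕ → Word) → ℕ → List Word → Set
  Holds mem b []       = ⊤
  Holds mem b (x ∷ xs) = mem b ≡ x × Holds mem (suc b) xs

  Holds-++⁻ : ∀ {mem} b xs {ys} → Holds mem b (xs ++ ys) → Holds mem b xs × Holds mem (length xs + b) ys
  Holds-++⁻ b []       h        = tt , h
  Holds-++⁻ {mem} b (x ∷ xs) {ys} (e , h) with Holds-++⁻ (suc b) xs h
  ... | hx , hy = (e , hx) , subst (λ a → Holds mem a ys) (+-suc (length xs) b) hy

  -- Address 0 holds the address of the root and the text starts at address 1, hence suc rep.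
  Represents : (mem : ℕ → Word) → ℕ → Tree w → Set
  Represents mem u fail =
    3 + u ≤ 2 ^ w × mem u ≡ word n × mem (1 + u) ≡ word 1 × mem (2 + u) ≡ word 0
  Represents mem u (node q rep ans a l child) =
    5 + 2 ^ l + u ≤ 2 ^ w ×
    mem u ≡ word q × mem (1 + u) ≡ word (suc rep) × mem (2 + u) ≡ ans ×
    mem (3 + u) ≡ word a × mem (4 + u) ≡ word (w ∸ l) ×
    (∀ i → i < 2 ^ l → ∃[ u′ ] (mem (5 + (i + u)) ≡ word u′ × Represents mem u′ (child i)))

  Represents⇒< : ∀ {mem u} t → Represents mem u t → u < 2 ^ w
  Represents⇒< fail                      (fits , _) = ≤-trans (m≤n+m _ 2) fits
  Represents⇒< (node q rep ans a l child) (fits , _) = ≤-trans (s≤s (m≤n+m _ (4 + 2 ^ l))) fits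

  -- The guarantee covers every memory that contains the words, so blocks can be built separately
  -- and concatenated, with the pattern still to be placed behind them.
  Block : ((ℕ → Word) → Set) → (b size : ℕ) → Set
  Block P b s = Σ[ ws ∈ List Word ] (length ws ≡ s × (∀ {mem} → Holds mem b ws → P mem))

  Allocates : Tree w → Set
  Allocates t = ∀ b → b + size t ≤ 2 ^ w → Block (λ mem → Represents mem b t) b (size t)

  -- Pointers and subtrees are returned apart because the whole pointer table precedes the subtrees
  -- in memory; its address `p` is left open.
  allocate-children : (child : ℕ → Tree w) → (∀ i → Allocates (child i)) →
    ∀ k b → b + ∑ k (λ i → size (child i)) ≤ 2 ^ w →
    Σ[ ptrs ∈ List Word ] (length ptrs ≡ k ×
      Block (λ mem → ∀ p → Holds mem p ptrs → ∀ i → i < k → ∃[ u ] (mem (i + p) ≡ word u × Represents mem u (child i)))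
            b (∑ k (λ i → size (child i))))
  allocate-children child alloc zero    b fits = [] , refl , [] , refl , λ _ _ _ _ ()
  allocate-children child alloc (suc k) b fits =
    let total = ∑ k (λ i → size (child i))
        fits′ = subst (_≤ 2 ^ w) (sym (+-assoc b total (size (child k)))) fits
        ptrs , #ptrs , ws , #ws , spec = allocate-children child alloc k b (≤-trans (m≤m+n _ _) fits′)
        ws′ , #ws′ , spec′ = alloc k (b + total) fits′
    in ptrs ∷ʳ word (b + total) , trans (length-++ ptrs) (trans (+-comm _ 1) (cong suc #ptrs)) ,
       ws ++ ws′ , trans (length-++ ws) (cong₂ _+_ #ws #ws′) ,
       λ {mem} held p ptrs-held i i≤k →
         let held-ws , held-ws′ = Holds-++⁻ b ws held
             held-ptrs , held-ptr , _ = Holds-++⁻ p ptrs ptrs-held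
         in pick {mem} total p #ptrs held-ptr (spec′ (subst (λ a → Holds mem a ws′) (trans (cong (_+ b) #ws) (+-comm total b)) held-ws′))
                 (spec held-ws p held-ptrs) i i≤k
    where
    pick : ∀ {mem} total p {j} → j ≡ k → mem (j + p) ≡ word (b + total) → Represents mem (b + total) (child k) →
           (∀ i → i < k → ∃[ u ] (mem (i + p) ≡ word u × Represents mem u (child i))) →
           ∀ i → i < suc k → ∃[ u ] (mem (i + p) ≡ word u × Represents mem u (child i))
    pick total p refl ptr rep earlier i i≤k with i ≟ k
    ... | yes refl = b + total , ptr , rep
    ... | no i≢k   = earlier i (≤∧≢⇒< (s≤s⁻¹ i≤k) i≢k)

  allocate : ∀ t → Allocates t
  allocate fail b fits =
    -- Read as a header, a leaf has `q = n`, representative 0 and answer 0. Since `m ≤ n`, the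
    -- program stops there as at a node, without telling the two apart.
    word n ∷ word 1 ∷ word 0 ∷ [] , refl ,
    λ { (h₀ , h₁ , h₂ , _) → subst (_≤ 2 ^ w) (+-comm b 3) fits , h₀ , h₁ , h₂ }
  allocate (node q rep ans a l child) b fits =
    let L = 2 ^ l
        total = ∑ L (λ i → size (child i))
        fits′ = subst (_≤ 2 ^ w) (rearrange b L total) fits
        ptrs , #ptrs , ws , #ws , spec = allocate-children child (λ i → allocate (child i)) L (L + (5 + b)) fits′
    in word q ∷ word (suc rep) ∷ ans ∷ word a ∷ word (w ∸ l) ∷ ptrs ++ ws ,
       cong (5 +_) (trans (length-++ ptrs) (cong₂ _+_ #ptrs #ws)) ,
       λ { {mem} (h₀ , h₁ , h₂ , h₃ , h₄ , held) →
           let held-ptrs , held-ws = Holds-++⁻ (5 + b) ptrs held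
               children = spec (subst (λ k → Holds mem (k + (5 + b)) ws) #ptrs held-ws) (5 + b) held-ptrs
           in ≤-trans (≤-reflexive (swap L b)) (≤-trans (m≤m+n _ total) fits′) , h₀ , h₁ , h₂ , h₃ , h₄ ,
              λ i i<L → let u , ptr , rep = children i i<L
                        in u , trans (cong mem (sym (shift i b))) ptr , rep }
    where
    rearrange : ∀ b L T → b + (5 + L + T) ≡ L + (5 + b) + T
    rearrange = solve-∀
    swap : ∀ L b → 5 + L + b ≡ L + (5 + b)
    swap = solve-∀
    shift : ∀ i b → i + (5 + b) ≡ 5 + (i + b)
    shift = solve-∀

-- The loop at 6 descends the trie, with the current node in register 2; the loop at 25 compares the
-- pattern with the text at the representative of the last node, backwards.
query : Program
query =
    const 7 3        -- 0
  ∷ const 8 4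
  ∷ const 9 5
  ∷ const 10 1
  ∷ const 11 2
  ∷ load 2 2
  ∷ load 3 2         -- 6
  ∷ op lt 4 3 0
  ∷ jumpz 4 21
  ∷ op add 4 1 3
  ∷ load 4 4
  ∷ op add 5 7 2
  ∷ load 5 5
  ∷ op mul 4 4 5
  ∷ op add 5 8 2
  ∷ load 5 5
  ∷ op shr 4 4 5
  ∷ op add 4 4 2
  ∷ op add 4 9 4
  ∷ load 2 4
  ∷ jump 6
  ∷ op add 3 10 2    -- 21
  ∷ load 3 3
  ∷ op add 4 11 2
  ∷ load 4 4
  ∷ jumpz 0 34       -- 25
  ∷ op sub 0 0 10
  ∷ op add 5 3 0
  ∷ load 5 5
  ∷ op add 6 1 0
  ∷ load 6 6
  ∷ op eq 5 5 6
  ∷ jumpz 5 36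
  ∷ jump 25
  ∷ op add 0 0 4     -- 34
  ∷ jump 37
  ∷ const 0 0        -- 36
  ∷ []

-- Execution of the query program

module _ {w : ℕ} where

  open RAM w

  run-+ : ∀ p s t {x} → run p (s + t) x ≡ run p t (run p s x)
  run-+ p zero    t = refl
  run-+ p (suc s) t = run-+ p s t

  run-halted : ∀ p t {x} → Halted p x → run p t x ≡ x
  run-halted p zero    halted = refl
  run-halted p (suc t) {x} halted rewrite halted = run-halted p t halted

  record Reaches (t : ℕ) (x y : State) : Set where
    constructor reached
    field run≡ : run query t x ≡ y

  open Reaches public

  infixr 5 _⟫_
  _⟫_ : ∀ {s t x y z} → Reaches s x y → Reaches t y z → Reaches (s + t) x z
  _⟫_ {s} {t} (reached refl) (reached r) = reached (trans (run-+ query s t) r)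

  settle : ∀ t x {k M} → pc (run query t x) ≡ k → memory (run query t x) ≡ M →
           Reaches t x (state k (regs (run query t x)) M)
  settle t x refl refl = reached refl

  -- Straight-line code runs by unfolding, but after `jumpz` the program counter is an `if` on a
  -- register whose value is known only by proof.
  branch-zero : ∀ t y {x : Word} {l k M} → pc (run query t y) ≡ (if toℕ x ≡ᵇ 0 then l else k) → memory (run query t y) ≡ M →
                toℕ x ≡ 0 → Reaches t y (state l (regs (run query t y)) M)
  branch-zero t y {l = l} {k} pc≡ mem≡ x≡0 = settle t y (trans pc≡ (cong (λ y → if y ≡ᵇ 0 then l else k) x≡0)) mem≡

  branch-suc : ∀ t y {x : Word} {l k j M} → pc (run query t y) ≡ (if toℕ x ≡ᵇ 0 then l else k) → memory (run query t y) ≡ M →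
               toℕ x ≡ suc j → Reaches t y (state k (regs (run query t y)) M)
  branch-suc t y {l = l} {k} pc≡ mem≡ x≡ = settle t y (trans pc≡ (cong (λ y → if y ≡ᵇ 0 then l else k) x≡)) mem≡

<ᵇ-true : ∀ {a b} → a < b → bit (a <ᵇ b) ≡ 1
<ᵇ-true {a} {b} a<b with a <ᵇ b | <⇒<ᵇ a<b
... | true | _ = refl

<ᵇ-false : ∀ {a b} → b ≤ a → bit (a <ᵇ b) ≡ 0
<ᵇ-false {a} {b} b≤a with a <ᵇ b in e≡
... | false = refl
... | true  = contradiction (<ᵇ⇒< a b (subst Bool.T (sym e≡) _)) (≤⇒≯ b≤a)

≡ᵇ-true : ∀ {a b} → a ≡ b → bit (a ≡ᵇ b) ≡ 1
≡ᵇ-true {a} {b} a≡b with a ≡ᵇ b | ≡⇒≡ᵇ a b a≡b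
... | true | _ = refl

≡ᵇ-false : ∀ {a b} → a ≢ b → bit (a ≡ᵇ b) ≡ 0
≡ᵇ-false {a} {b} a≢b with a ≡ᵇ b in e≡
... | false = refl
... | true  = contradiction (≡ᵇ⇒≡ a b (subst Bool.T (sym e≡) _)) a≢b

module Execution
  (w n d m : ℕ) (mem px text : ℕ → RAM.Word w)
  (pattern-at : ∀ j → j < m → mem (d + j) ≡ px j)
  (text-at : ∀ i → i < n → mem (1 + i) ≡ text i)
  (pattern-fits : d + m ≤ 2 ^ w) (text-fits : n < d) (m≤n : m ≤ n) (12≤2^w : 12 ≤ 2 ^ w) (w<2^w : w < 2 ^ w) where

  open RAM w
  open Words w
  open Layout w n

  M : Word → Word
  M a = mem (toℕ a)

  private
    small : ∀ {x} → x ≤ 11 → x < 2 ^ w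
    small x≤ = ≤-trans (s≤s x≤) 12≤2^w

    n<2^w : n < 2 ^ w
    n<2^w = <-≤-trans text-fits (≤-trans (m≤m+n d m) pattern-fits)

    mem-at : ∀ {r a x} → r ≐ a → mem a ≡ x → M r ≡ x
    mem-at (value refl) e = e

    mem-word : ∀ {r a x} → r ≐ a → mem a ≡ word x → x < 2 ^ w → M r ≐ x
    mem-word (value refl) e x< = value (trans (cong toℕ e) (toℕ-word-< x<))

  -- Invariant of the descent loop; registers 3 to 5 are scratch.
  record Descending (R : Reg → Word) (u : ℕ) : Set where
    field
      r0  : R 0 ≐ m
      r1  : R 1 ≐ d
      r2  : R 2 ≐ u
      r7  : R 7 ≐ 3
      r8  : R 8 ≐ 4
      r9  : R 9 ≐ 5
      r10 : R 10 ≐ 1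
      r11 : R 11 ≐ 2

  -- Invariant of the comparison loop. Register 0, so far the pattern length, becomes the number of
  -- characters still to compare.
  record Verifying (R : Reg → Word) (j rep : ℕ) (ans : Word) : Set where
    field
      r0  : R 0 ≐ j
      r1  : R 1 ≐ d
      r3  : R 3 ≐ suc rep
      r4  : R 4 ≡ ans
      r10 : R 10 ≐ 1

  -- Mentions only the three header words that nodes and `fail` leaves have in common.
  leave-trie : ∀ {R u q rep ans} → Descending R u → 3 + u ≤ 2 ^ w → m ≤ q → q ≤ n → rep + m ≤ n → 1 ≤ m →
               mem u ≡ word q → mem (1 + u) ≡ word (suc rep) → mem (2 + u) ≡ ans →
               Σ[ R′ ∈ (Reg → Word) ] (Reaches 7 (state 6 R M) (state 25 R′ M) × Verifying R′ m rep ans)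
  leave-trie {R} {u} {q} {rep} D u< m≤q q≤n rep≤ 1≤m q≡ rep≡ ans≡ =
    regs (run query 4 (state 21 R₁ M)) ,
    (branch-zero 3 (state 6 R M) {x = R₁ 4} {k = 9} refl refl (toℕ≡ not-less) ⟫ settle 4 (state 21 R₁ M) refl refl) ,
    record
      { r0 = r0 ; r1 = r1
      ; r3 = mem-word (eval-< add r10 r2 (≤-trans (n≤1+n _) u<)) rep≡ (≤-<-trans (≤-trans (≤-reflexive (+-comm 1 rep)) (≤-trans (+-monoʳ-≤ rep 1≤m) rep≤)) n<2^w)
      ; r4 = mem-at (eval-< add r11 r2 u<) ans≡
      ; r10 = r10 }
    where
    open Descending D
    R₁ : Reg → Word
    R₁ = regs (run query 3 (state 6 R M))
    not-less : R₁ 4 ≐ 0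
    not-less = subst (evalOp lt (M (R 2)) (R 0) ≐_) (<ᵇ-false m≤q)
      (eval-< lt (mem-word r2 q≡ (≤-<-trans q≤n n<2^w)) r0 (subst (_< 2 ^ w) (sym (<ᵇ-false m≤q)) (small z≤n)))

  descend-step : ∀ {R u q rep ans a l child} → Descending R u → Represents mem u (node q rep ans a l child) → q < m →
    let i = hash w l a (toℕ (px q)) in
    Σ[ R′ ∈ (Reg → Word) ] ∃[ u′ ] (Reaches 15 (state 6 R M) (state 6 R′ M) × Descending R′ u′ × Represents mem u′ (child i))
  descend-step {R} {u} {q} {rep} {ans} {a} {l} {child} D (fits , q≡ , _ , _ , a≡ , shift≡ , children) q<m =
    regs (run query 12 (state 9 R₁ M)) , u′ ,
    (branch-suc 3 (state 6 R M) {x = R₁ 4} {l = 21} refl refl (toℕ≡ is-less) ⟫ settle 12 (state 9 R₁ M) refl refl) ,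
    record
      { r0 = r0 ; r1 = r1
      ; r2 = mem-word (eval-< add r9 (eval-< add index r2 (≤-trans (m≤n+m _ 5) entry<)) entry<) ptr≡ (Represents⇒< (child i) rep′)
      ; r7 = r7 ; r8 = r8 ; r9 = r9 ; r10 = r10 ; r11 = r11 } ,
    rep′
    where
    open Descending D
    i : ℕ
    i = hash w l a (toℕ (px q))
    i< : i < 2 ^ l
    i< = hash<2^l w l a (toℕ (px q))
    u′ : ℕ
    u′ = proj₁ (children i i<)
    ptr≡ : mem (5 + (i + u)) ≡ word u′
    ptr≡ = proj₁ (proj₂ (children i i<))
    rep′ : Represents mem u′ (child i)
    rep′ = proj₂ (proj₂ (children i i<))
    R₁ : Reg → Word
    R₁ = regs (run query 3 (state 6 R M))
    q<2^w : q < 2 ^ w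
    q<2^w = <-trans q<m (≤-<-trans m≤n n<2^w)
    entry< : 5 + (i + u) < 2 ^ w
    entry< = ≤-trans (≤-reflexive (rearrange i u)) (≤-trans (+-monoˡ-≤ u (+-monoʳ-≤ 5 i<)) fits)
      where rearrange : ∀ i u → suc (5 + (i + u)) ≡ 5 + suc i + u
            rearrange = solve-∀
    header< : ∀ {k} → k ≤ 4 → k + u < 2 ^ w
    header< k≤4 = ≤-<-trans (+-monoˡ-≤ u k≤4) (≤-trans (≤-trans (s≤s (+-monoʳ-≤ 4 (m≤n+m u i))) (n≤1+n _)) entry<)
    q-loaded : M (R 2) ≐ q
    q-loaded = mem-word r2 q≡ q<2^w
    is-less : R₁ 4 ≐ 1
    is-less = subst (evalOp lt (M (R 2)) (R 0) ≐_) (<ᵇ-true q<m)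
      (eval-< lt q-loaded r0 (subst (_< 2 ^ w) (sym (<ᵇ-true q<m)) (small (s≤s z≤n))))
    char : M (evalOp add (R 1) (M (R 2))) ≡ px q
    char = mem-at (eval-< add r1 q-loaded (<-≤-trans (+-monoʳ-< d q<m) pattern-fits)) (pattern-at q q<m)
    multiplier : toℕ (M (evalOp add (R 7) (R 2))) ≡ a %2^ w
    multiplier = trans (cong toℕ (mem-at (eval-< add r7 r2 (header< (n≤1+n 3))) a≡)) (toℕ-word a)
    shift : M (evalOp add (R 8) (R 2)) ≐ (w ∸ l)
    shift = mem-word (eval-< add r8 r2 (header< ≤-refl)) shift≡ (≤-<-trans (m∸n≤m w l) w<2^w)
    index : evalOp shr (evalOp mul (M (evalOp add (R 1) (M (R 2)))) (M (evalOp add (R 7) (R 2)))) (M (evalOp add (R 8) (R 2))) ≐ i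
    index = subst (λ c → evalOp shr (evalOp mul (M (evalOp add (R 1) (M (R 2)))) (M (evalOp add (R 7) (R 2)))) (M (evalOp add (R 8) (R 2))) ≐ hash w l a (toℕ c))
                  char (eval-hash l a {c = M (evalOp add (R 1) (M (R 2)))} multiplier shift)

  walk-trie : ∀ {t k rep ans R u} → Walk n m px t k rep ans → rep + m ≤ n → 1 ≤ m → Represents mem u t → Descending R u →
    Σ[ R′ ∈ (Reg → Word) ] (Reaches (k * 15 + 7) (state 6 R M) (state 25 R′ M) × Verifying R′ m rep ans)
  walk-trie halt-fail rep≤ 1≤m (fits , n≡ , rep≡ , ans≡) D =
    leave-trie D fits m≤n ≤-refl rep≤ 1≤m n≡ rep≡ ans≡
  walk-trie {t = node q rep ans a l child} {u = u} (halt m≤q q≤n) rep≤ 1≤m (fits , q≡ , rep≡ , ans≡ , _) D =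
    leave-trie D (≤-trans (≤-trans (+-monoˡ-≤ u (m≤m+n 3 (2 ^ l))) (m≤n+m _ 2)) fits) m≤q q≤n rep≤ 1≤m q≡ rep≡ ans≡
  walk-trie {R = R} (descend {a = a} {l} {child} q<m walk) rep≤ 1≤m represents D =
    let R₁ , u′ , reach , D₁ , represents′ = descend-step {a = a} {l} {child} D represents q<m
        R′ , reach′ , V = walk-trie walk rep≤ 1≤m represents′ D₁
    in R′ , reach ⟫ reach′ , V

  Verified : (j rep : ℕ) (ans answer : Word) → Set
  Verified j rep ans answer =
    ((∀ p → p < j → text (rep + p) ≡ px p) × toℕ answer ≡ toℕ ans) ⊎
    ∃[ p ] (p < j × text (rep + p) ≢ px p × toℕ answer ≡ 0)

  verify : ∀ j {R rep ans} → j ≤ m → rep + m ≤ n → Verifying R j rep ans →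
    ∃[ t ] Σ[ R′ ∈ (Reg → Word) ] (t ≤ j * 9 + 9 × Reaches t (state 25 R M) (state 37 R′ M) × Verified j rep ans (R′ 0))
  verify zero {R} {rep} {ans} _ _ V =
    -- Register 0 has counted down to 0, so adding register 4 to it copies the answer.
    3 , regs (run query 2 (state 34 R M)) , s≤s (s≤s (s≤s z≤n)) ,
    branch-zero 1 (state 25 R M) {x = R 0} {k = 26} refl refl (toℕ≡ r0) ⟫ settle 2 (state 34 R M) refl refl ,
    inj₁ ((λ _ ()) , toℕ≡ (eval-< add r0 (value (cong toℕ r4)) (Fin.toℕ<n ans)))
    where open Verifying V
  verify (suc j) {R} {rep} {ans} j<m rep≤ V = compared (text (rep + j) Fin.≟ px j)
    where
    open Verifying V
    R₁ R₂ : Reg → Word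
    R₁ = regs (run query 6 (state 26 R M))
    R₂ = regs (run query 1 (state 36 R₁ M))
    to-26 : Reaches 1 (state 25 R M) (state 26 R M)
    to-26 = branch-suc 1 (state 25 R M) {x = R 0} {l = 34} refl refl (toℕ≡ r0)
    decremented : R₁ 0 ≐ j
    decremented = eval-decrement (small (s≤s z≤n)) r0 r10
    text-char : M (evalOp add (R 3) (R₁ 0)) ≡ text (rep + j)
    text-char = mem-at (eval-< add r3 decremented (≤-<-trans position≤ n<2^w)) (text-at (rep + j) position≤)
      where position≤ : suc (rep + j) ≤ n
            position≤ = ≤-trans (≤-reflexive (sym (+-suc rep j))) (≤-trans (+-monoʳ-≤ rep j<m) rep≤)
    pattern-char : M (evalOp add (R 1) (R₁ 0)) ≡ px j
    pattern-char = mem-at (eval-< add r1 decremented (<-≤-trans (+-monoʳ-< d j<m) pattern-fits)) (pattern-at j j<m)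
    equal-bit : ∀ {b} → bit (toℕ (text (rep + j)) ≡ᵇ toℕ (px j)) ≡ b → b ≤ 11 → R₁ 5 ≐ b
    equal-bit {b} b≡ b≤ = subst (R₁ 5 ≐_) b≡
      (eval-< eq {x = M (evalOp add (R 3) (R₁ 0))} {y = M (evalOp add (R 1) (R₁ 0))}
              (value (cong toℕ text-char)) (value (cong toℕ pattern-char)) (subst (_< 2 ^ w) (sym b≡) (small b≤)))
    to-compared : Reaches 7 (state 25 R M) (state 32 R₁ M)
    to-compared = to-26 ⟫ settle 6 (state 26 R M) refl refl
    compared : Dec (text (rep + j) ≡ px j) →
      ∃[ t ] Σ[ R′ ∈ (Reg → Word) ] (t ≤ suc j * 9 + 9 × Reaches t (state 25 R M) (state 37 R′ M) × Verified (suc j) rep ans (R′ 0))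
    compared (no differ) = 9 , R₂ , m≤n+m 9 (suc j * 9) ,
      to-compared ⟫
      branch-zero 1 (state 32 R₁ M) {x = R₁ 5} {k = 33} refl refl
        (toℕ≡ (equal-bit (≡ᵇ-false (λ e → differ (Fin.toℕ-injective e))) z≤n)) ⟫
      settle 1 (state 36 R₁ M) refl refl ,
      inj₂ (j , ≤-refl , differ , toℕ-word-< (small z≤n))
    compared (yes same) =
      let t , R′ , t≤ , reach , verified = verify j (<⇒≤ j<m) rep≤
            record { r0 = decremented ; r1 = r1 ; r3 = r3 ; r4 = r4 ; r10 = r10 }
      in 9 + t , R′ , +-monoʳ-≤ 9 t≤ ,
         to-compared ⟫
         branch-suc 1 (state 32 R₁ M) {x = R₁ 5} {l = 36} refl refl (toℕ≡ (equal-bit (≡ᵇ-true (cong toℕ same)) (s≤s z≤n))) ⟫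
         settle 1 (state 33 R₁ M) refl refl ⟫ reach ,
         extend verified
      where
      extend : ∀ {answer} → Verified j rep ans answer → Verified (suc j) rep ans answer
      extend (inj₂ (p , p<j , differ , zero≡)) = inj₂ (p , m<n⇒m<1+n p<j , differ , zero≡)
      extend (inj₁ (match , ans≡)) = inj₁ (longer , ans≡)
        where
        longer : ∀ p → p < suc j → text (rep + p) ≡ px p
        longer p p≤j with p ≟ j
        ... | yes refl = same
        ... | no p≢j   = match p (≤∧≢⇒< (s≤s⁻¹ p≤j) p≢j)

  answer-query : ∀ {t k rep ans R root} → Walk n m px t k rep ans → rep + m ≤ n → 1 ≤ m →
    k ≤ 2 * m → R 0 ≐ m → R 1 ≐ d → R 2 ≡ word 0 → mem 0 ≡ word root → Represents mem root t →
    Σ[ R′ ∈ (Reg → Word) ] (Reaches (61 * m) (state 0 R M) (state 37 R′ M) × Verified m rep ans (R′ 0))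
  answer-query {t} {k} {rep} {ans} {R} {root} walk rep≤ 1≤m k≤ r0 r1 r2 root≡ represents =
    let R₁ , reach₁ , V = walk-trie walk rep≤ 1≤m represents D
        c , R₂ , c≤ , reach₂ , verified = verify m ≤-refl rep≤ V
    in R₂ , stay (cost c c≤) (settle 6 (state 0 R M) refl refl ⟫ reach₁ ⟫ reach₂) , verified
    where
    -- The number of steps is fixed to `61 * m`, so a query that halts earlier idles; a halted state
    -- does not change.
    stay : ∀ {s s′ x R} → s ≤ s′ → Reaches s x (state 37 R M) → Reaches s′ x (state 37 R M)
    stay {s} {s′} {x} {R} s≤s′ reach = subst (λ s → Reaches s x (state 37 R M)) (m+[n∸m]≡n s≤s′)
      (reach ⟫ reached {t = s′ ∸ s} (run-halted query (s′ ∸ s) refl))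
    R₀ : Reg → Word
    R₀ = regs (run query 6 (state 0 R M))
    D : Descending R₀ root
    D = record
      { r0 = r0 ; r1 = r1
      ; r2 = mem-word (value (trans (cong toℕ r2) (toℕ-word-< (small z≤n)))) root≡ (Represents⇒< t represents)
      ; r7 = value (toℕ-word-< (small (m≤m+n 3 8))) ; r8 = value (toℕ-word-< (small (m≤m+n 4 7)))
      ; r9 = value (toℕ-word-< (small (m≤m+n 5 6))) ; r10 = value (toℕ-word-< (small (m≤m+n 1 10)))
      ; r11 = value (toℕ-word-< (small (m≤m+n 2 9))) }
    cost : ∀ c → c ≤ m * 9 + 9 → 6 + (k * 15 + 7 + c) ≤ 61 * m
    cost c c≤ = begin
      6 + (k * 15 + 7 + c)                        ≤⟨ +-monoʳ-≤ 6 (+-mono-≤ (+-monoˡ-≤ 7 (*-monoˡ-≤ 15 k≤)) c≤) ⟩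
      -- 6 instructions of set-up, 15 for each of at most `2 * m` descents, 7 to leave the trie, 9
      -- per character compared and at most 9 to finish; `1 ≤ m` absorbs the constant 22.
      6 + (2 * m * 15 + 7 + (m * 9 + 9))          ≡⟨ collect m ⟩
      22 * 1 + 39 * m                             ≤⟨ +-monoˡ-≤ (39 * m) (*-monoʳ-≤ 22 1≤m) ⟩
      22 * m + 39 * m                             ≡⟨ total m ⟩
      61 * m                                      ∎
      where
      open ≤-Reasoning
      collect : ∀ m → 6 + (2 * m * 15 + 7 + (m * 9 + 9)) ≡ 22 * 1 + 39 * m
      collect = solve-∀
      total : ∀ m → 22 * m + 39 * m ≡ 61 * m
      total = solve-∀

-- Counting consecutive occurrences

∑ₗ-cartesianProduct : {A B : Set} (xs : List A) (ys : List B) (f : A × B → ℕ) →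
                      ∑ₗ (cartesianProduct xs ys) f ≡ ∑ₗ xs (λ x → ∑ₗ ys (λ y → f (x , y)))
∑ₗ-cartesianProduct {A} {B} []       ys f = refl
∑ₗ-cartesianProduct {A} {B} (x ∷ xs) ys f = trans (row ys) (cong (∑ₗ ys (λ y → f (x , y)) +_) (∑ₗ-cartesianProduct xs ys f))
  where
  row : ∀ zs → ∑ₗ (map (x ,_) zs ++ cartesianProduct xs ys) f ≡ ∑ₗ zs (λ y → f (x , y)) + ∑ₗ (cartesianProduct xs ys) f
  row []       = refl
  row (z ∷ zs) = trans (cong (f (x , z) +_) (row zs)) (sym (+-assoc (f (x , z)) _ _))

count-functional : {A B : Set} {R : A × B → Set} (R? : ∀ xy → Dec (R xy)) (xs : List A) {ys : List B} → Unique ys →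
                   (∀ {x y y′} → R (x , y) → R (x , y′) → y ≡ y′) → length (filter R? (cartesianProduct xs ys)) ≤ length xs
count-functional R? xs {ys} uq functional = begin
  length (filter R? (cartesianProduct xs ys))                  ≡⟨ length-filter-∑ₗ R? (cartesianProduct xs ys) ⟩
  ∑ₗ (cartesianProduct xs ys) (λ xy → indicator (R? xy))       ≡⟨ ∑ₗ-cartesianProduct xs ys _ ⟩
  ∑ₗ xs (λ x → ∑ₗ ys (λ y → indicator (R? (x , y))))           ≤⟨ ∑ₗ-mono xs (λ {x} _ → ∑ₗ-unique (λ y → R? (x , y)) uq functional) ⟩
  ∑ₗ xs (λ _ → 1)                                              ≡⟨ trans (∑ₗ-const xs 1) (*-identityʳ (length xs)) ⟩
  length xs                                                    ∎
  where open ≤-Reasoning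

module _ {σ : ℕ} (T : List (Fin σ)) (α β : ℤ) where

  open import Data.Integer.Base using (+_)

  -- The second member of a pair is determined by the first, as two candidates would have one
  -- strictly between the other and the first. The bound lets the count fit into a word.
  countConsecutiveOcc-≤ : ∀ P → countConsecutiveOcc T P α β ≤ length T
  countConsecutiveOcc-≤ P = subst (countConsecutiveOcc T P α β ≤_) (length-tabulate {n = length T} (λ i → i))
    (count-functional (consecutiveOcc? T P α β) (allFin (length T)) (Unique.allFin⁺ (length T)) next-unique)
    where
    next-unique : ∀ {i j j′} → ConsecutiveOcc T P α β (i , j) → ConsecutiveOcc T P α β (i , j′) → j ≡ j′
    next-unique {i} {j} {j′} (_ , occ-j , i<j , none , _) (_ , occ-j′ , i<j′ , none′ , _) with Fin.<-cmp j j′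
    ... | tri< j<j′ _ _ = contradiction occ-j (none′ j i<j j<j′)
    ... | tri≈ _ j≡j′ _ = j≡j′
    ... | tri> _ _ j′<j = contradiction occ-j′ (none j′ i<j′ j′<j)

  -- An arbitrary set takes the place of the occurrences of a pattern: this is what a node can
  -- evaluate and store before any pattern is known.
  ConsecutiveIn : List ℕ → Fin (length T) × Fin (length T) → Set
  ConsecutiveIn S (i , j) =
      toℕ i ∈ S × toℕ j ∈ S
    × i Fin.< j
    × (∀ (k : Fin (length T)) → i Fin.< k → k Fin.< j → ¬ toℕ k ∈ S)
    × α ℤ.≤ gap × gap ℤ.≤ β
    where gap = + toℕ j ℤ.- + toℕ i

  consecutiveIn? : ∀ S ij → Dec (ConsecutiveIn S ij)
  consecutiveIn? S (i , j) =
          (toℕ i ∈? S) ×-dec (toℕ j ∈? S)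
    ×-dec (i Fin.<? j)
    ×-dec Fin.all? (λ k → (i Fin.<? k) →-dec ((k Fin.<? j) →-dec ¬? (toℕ k ∈? S)))
    ×-dec (α ℤ.≤? _) ×-dec (_ ℤ.≤? β)
    where open DecMembership _≟_ using (_∈?_)

  countConsecutiveIn : List ℕ → ℕ
  countConsecutiveIn S = length (filter (consecutiveIn? S) (cartesianProduct (allFin (length T)) (allFin (length T))))

  count-≡ : ∀ {P S} → (∀ i → Occ T P i → toℕ i ∈ S) → (∀ i → toℕ i ∈ S → Occ T P i) →
            countConsecutiveOcc T P α β ≡ countConsecutiveIn S
  count-≡ {P} {S} to from = cong length (filter-≐ (consecutiveOcc? T P α β) (consecutiveIn? S)
    ((λ { {i , j} (occ-i , occ-j , i<j , none , gap) → to i occ-i , to j occ-j , i<j , (λ k i<k k<j k∈ → none k i<k k<j (from k k∈)) , gap }) ,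
     (λ { {i , j} (i∈ , j∈ , i<j , none , gap) → from i i∈ , from j j∈ , i<j , (λ k i<k k<j occ-k → none k i<k k<j (to k occ-k)) , gap }))
    (cartesianProduct (allFin (length T)) (allFin (length T))))

  count-0 : ∀ {P} → (∀ i → ¬ Occ T P i) → countConsecutiveOcc T P α β ≡ 0
  count-0 {P} none = cong length (filter-none (consecutiveOcc? T P α β)
    (All.universal (λ { (i , _) (occ-i , _) → none i occ-i }) (cartesianProduct (allFin (length T)) (allFin (length T)))))

-- Occurrences as equalities of memory cells

module _ {w : ℕ} where

  open RAM w

  cell-drop : ∀ ws i j → cell (drop i ws) j ≡ cell ws (i + j)
  cell-drop ws       zero    j       = refl
  cell-drop []       (suc i) zero    = refl
  cell-drop []       (suc i) (suc j) = refl
  cell-drop (x ∷ ws) (suc i) j       = cell-drop ws i j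

  cell-++ˡ : ∀ xs {ys} i → i < length xs → cell (xs ++ ys) i ≡ cell xs i
  cell-++ˡ (x ∷ xs) zero    _         = refl
  cell-++ˡ (x ∷ xs) (suc i) (s≤s i<n) = cell-++ˡ xs i i<n

  cell-++ʳ : ∀ xs {ys} j → cell (xs ++ ys) (length xs + j) ≡ cell ys j
  cell-++ʳ []       j = refl
  cell-++ʳ (x ∷ xs) j = cell-++ʳ xs j

  holds-middle : ∀ n xs ys {zs} → Layout.Holds w n (cell (xs ++ ys ++ zs)) (length xs) ys
  holds-middle n xs []            = tt
  holds-middle n xs (y ∷ ys) {zs} = trans (cong (cell (xs ++ y ∷ ys ++ zs)) (sym (+-identityʳ (length xs)))) (cell-++ʳ xs 0) ,
    subst₂ (λ ws k → Layout.Holds w n (cell ws) k ys) (++-assoc xs (y ∷ []) (ys ++ zs))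
           (trans (length-++ xs) (+-comm (length xs) 1)) (holds-middle n (xs ∷ʳ y) ys)

  module _ {σ : ℕ} .(σ≤2^w : σ ≤ 2 ^ w) where

    prefix⇒cells : ∀ {P L : List (Fin σ)} → Prefix _≡_ P L →
                   length P ≤ length L × (∀ j → j < length P → cell (encode σ≤2^w L) j ≡ cell (encode σ≤2^w P) j)
    prefix⇒cells []           = z≤n , λ _ ()
    prefix⇒cells (refl ∷ pre) with prefix⇒cells pre
    ... | ≤L , same = s≤s ≤L , λ { zero _ → refl ; (suc j) (s≤s j<) → same j j< }

    -- The length condition excludes false matches past the end of `L`, where `cell` returns 0,
    -- which is also the code of a character.
    cells⇒prefix : ∀ (P L : List (Fin σ)) → length P ≤ length L →
                   (∀ j → j < length P → cell (encode σ≤2^w L) j ≡ cell (encode σ≤2^w P) j) → Prefix _≡_ P L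
    cells⇒prefix []      L       _         _    = []
    cells⇒prefix (x ∷ P) (y ∷ L) (s≤s ≤L) same =
      Fin.inject≤-injective σ≤2^w σ≤2^w x y (sym (same 0 (s≤s z≤n))) ∷ cells⇒prefix P L ≤L (λ j j< → same (suc j) (s≤s j<))

    module _ (T P : List (Fin σ)) where

      private
        Matches : ℕ → Set
        Matches i = i + length P ≤ length T ×
                    (∀ j → j < length P → cell (encode σ≤2^w T) (i + j) ≡ cell (encode σ≤2^w P) j)

        cell-suffix : ∀ i j → cell (encode σ≤2^w (drop i T)) j ≡ cell (encode σ≤2^w T) (i + j)
        cell-suffix i j = trans (cong (λ ws → cell ws j) (sym (drop-map i T))) (cell-drop (encode σ≤2^w T) i j)

      occ⇒match : ∀ i → Occ T P i → Matches (toℕ i)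
      occ⇒match i occ with prefix⇒cells occ
      ... | ≤L , same = ≤-trans (+-monoʳ-≤ (toℕ i) (≤-trans ≤L (≤-reflexive (length-drop (toℕ i) T))))
                                (≤-reflexive (m+[n∸m]≡n (<⇒≤ (Fin.toℕ<n i)))) ,
                        λ j j< → trans (sym (cell-suffix (toℕ i) j)) (same j j<)

      match⇒occ : ∀ i → Matches (toℕ i) → Occ T P i
      match⇒occ i (fits , same) = cells⇒prefix P (drop (toℕ i) T)
        (≤-trans (m+n≤o⇒m≤o∸n (length P) (subst (_≤ length T) (+-comm (toℕ i) (length P)) fits)) (≤-reflexive (sym (length-drop (toℕ i) T))))
        (λ j j< → trans (cell-suffix (toℕ i) j) (same j j<))

n<2^n : ∀ n → n < 2 ^ n
n<2^n zero    = ≤-refl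
n<2^n (suc n) = ≤-trans (+-mono-≤ (m^n>0 2 n) (n<2^n n)) (≤-reflexive (cong (2 ^ n +_) (sym (+-identityʳ (2 ^ n)))))

-- The data structure of a nonempty text

module Index (v σ : ℕ) (σ≤2^w : σ ≤ 2 ^ suc v) (T : List (Fin σ)) (α β : ℤ)
             (1≤n : 1 ≤ length T) (fits : 105 * length T ≤ 2 ^ suc v) where

  private
    w = suc v
    n = length T

  open RAM w

  text : ℕ → Word
  text = cell (encode σ≤2^w T)

  answer : List ℕ → Word
  answer S = word (countConsecutiveIn T α β S)

  open Trie v n text answer
  open Layout w n

  positions : ∃[ t ] Good 0 (upTo n) t
  positions = trie (suc n) 0 0 (upTo n) ≤-refl (∈-upTo⁺ 1≤n)
                   (λ {i} i∈ → ≤-trans (≤-reflexive (+-identityʳ i)) (<⇒≤ (∈-upTo⁻ i∈))) (λ _ _ ())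

  root : Tree w
  root = proj₁ positions

  size-root : size root ≤ 102 * n
  size-root = ≤-trans (m≤m+n (size root) 87) (≤-trans (proj₁ (proj₂ positions)) (≤-reflexive (cong (102 *_) (length-upTo n))))

  space : suc n + size root ≤ 104 * n
  space = ≤-trans (+-mono-≤ (+-monoˡ-≤ n 1≤n) size-root) (≤-reflexive (collect n))
    where collect : ∀ n → n + n + 102 * n ≡ 104 * n
          collect = solve-∀

  block : Block (λ mem → Represents mem (suc n) root) (suc n) (size root)
  block = allocate root (suc n) (≤-trans space (≤-trans (*-monoˡ-≤ n (n≤1+n 104)) fits))

  D : List Word
  D = word (suc n) ∷ encode σ≤2^w T ++ proj₁ block

  length-D : length D ≡ suc n + size root
  length-D = cong suc (trans (length-++ (encode σ≤2^w T)) (cong₂ _+_ (length-map _ T) (proj₁ (proj₂ block))))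

  module Query (P : List (Fin σ)) (1≤m : 1 ≤ length P) (m≤n : length P ≤ n) where

    private
      m = length P
      d = length D
      Q = encode σ≤2^w P

    mem px : ℕ → Word
    mem = cell (D ++ Q)
    px = cell Q

    D-fits : d + m ≤ 2 ^ w
    D-fits = ≤-trans (+-mono-≤ (≤-trans (≤-reflexive length-D) space) m≤n) (≤-trans (≤-reflexive (+-comm (104 * n) n)) fits)

    n<d : n < d
    n<d = ≤-trans (m≤m+n (suc n) (size root)) (≤-reflexive (sym length-D))

    n<2^w : n < 2 ^ w
    n<2^w = <-≤-trans n<d (≤-trans (m≤m+n d m) D-fits)

    text-at : ∀ i → i < n → mem (1 + i) ≡ text i
    text-at i i<n = trans (cell-++ˡ {w} (encode σ≤2^w T ++ proj₁ block) i
                            (≤-trans i<n (≤-trans (≤-reflexive (sym (length-map _ T))) (≤-trans (m≤m+n _ _) (≤-reflexive (sym (length-++ (encode σ≤2^w T))))))))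
                          (cell-++ˡ {w} (encode σ≤2^w T) i (≤-trans i<n (≤-reflexive (sym (length-map _ T)))))

    root-represented : Represents mem (suc n) root
    root-represented = proj₂ (proj₂ block)
      (subst₂ (λ ws k → Holds (cell ws) k (proj₁ block))
              (cong (word (suc n) ∷_) (sym (++-assoc (encode σ≤2^w T) (proj₁ block) Q)))
              (cong suc (length-map _ T))
              (holds-middle {w} n (word (suc n) ∷ encode σ≤2^w T) (proj₁ block)))

    open Execution w n d m mem px text (λ j _ → cell-++ʳ {w} D j) text-at D-fits n<d m≤n
      (≤-trans (≤-trans (m≤m+n 12 93) (*-monoʳ-≤ 105 1≤n)) fits) (n<2^n w)

    count : ℕ
    count = countConsecutiveOcc T P α β

    match<n : ∀ i → Match m px i → i < n
    match<n i (i+m≤n , _) = ≤-trans (≤-trans (≤-reflexive (+-comm 1 i)) (+-monoʳ-≤ i 1≤m)) i+m≤n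

    verified⇒count : ∀ {rep ans a} → Outcome m px rep ans → Verified m rep ans a → toℕ a ≡ count
    verified⇒count {rep} (rep≤ , right , _) (inj₁ (match , a≡)) with right (rep≤ , match)
    ... | S , refl , matches⊆S , S⊆matches = trans a≡ (trans (Words.toℕ-word-< w (≤-<-trans (≤-reflexive (sym count≡)) count<)) (sym count≡))
      where
      count≡ : count ≡ countConsecutiveIn T α β S
      count≡ = count-≡ T α β {P} {S} (λ i occ → matches⊆S (toℕ i) (occ⇒match {w} σ≤2^w T P i occ))
                                     (λ i i∈S → match⇒occ {w} σ≤2^w T P i (S⊆matches (toℕ i) i∈S))
      count< : count < 2 ^ w
      count< = ≤-<-trans (countConsecutiveOcc-≤ T α β P) n<2^w
    verified⇒count (_ , _ , rep-matches) (inj₂ (p , p<m , differ , a≡0)) = trans a≡0 (sym (count-0 T α β {P}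
      (λ i occ → differ (proj₂ (rep-matches (toℕ i) (occ⇒match {w} σ≤2^w T P i occ)) p p<m))))

    returns : Returns query D Q count (61 * m)
    returns =
      let k , rep , ans , walk , k≤ , outcome = proj₂ (proj₂ positions) m px m≤n (λ i match → ∈-upTo⁺ (match<n i match))
          R , reach , verified = answer-query walk (proj₁ outcome) 1≤m k≤
            (value (trans (Words.toℕ-word-< w (≤-<-trans (≤-reflexive (length-map _ P)) (≤-<-trans m≤n n<2^w))) (length-map _ P)))
            (value (Words.toℕ-word-< w (<-≤-trans (≤-trans (≤-reflexive (+-comm 1 d)) (+-monoʳ-≤ d 1≤m)) D-fits)))
            refl refl root-represented
      in record
        { halted    = trans (cong (λ s → fetch query (pc s)) (run≡ reach)) refl
        ; output    = trans (cong (λ s → toℕ (regs s 0)) (run≡ reach)) (verified⇒count outcome verified)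
        ; preserved = λ a a<d → trans (cong (λ s → memory s a) (run≡ reach)) (cell-++ˡ {w} D (toℕ a) a<d) }
      where open Words w using (value)

theorem4p2 : Σ[ query ∈ Program ] ∃[ cWord ] ∃[ cSpace ] ∃[ cTime ]
    ((w σ : ℕ) (σ≤2^w : σ ≤ 2 ^ w) (T : List (Fin σ)) (α β : ℤ) →
    cWord * length T ≤ 2 ^ w →
    α ℤ.≤ β →
    let open RAM w in
    Σ[ D ∈ List Word ]
    (length D ≤ cSpace * length T ×
    ((P : List (Fin σ)) → 1 ≤ length P → length P ≤ length T →
    Returns query D (encode σ≤2^w P) (countConsecutiveOcc T P α β) (cTime * length P))))
-- Per character of the text: 102 words for the trie, one for the text, and one that pays for the
-- root pointer of a nonempty text, in total 104. The pattern behind them takes at most one more,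
-- and all 105 must be addressable.
theorem4p2 = query , 105 , 104 , 61 , index
  where
  index : (w σ : ℕ) (σ≤2^w : σ ≤ 2 ^ w) (T : List (Fin σ)) (α β : ℤ) →
    105 * length T ≤ 2 ^ w →
    α ℤ.≤ β →
    let open RAM w in
    Σ[ D ∈ List Word ]
    (length D ≤ 104 * length T ×
    ((P : List (Fin σ)) → 1 ≤ length P → length P ≤ length T →
    Returns query D (encode σ≤2^w P) (countConsecutiveOcc T P α β) (61 * length P)))
  index w       σ σ≤2^w []         α β _    _ = [] , z≤n , λ P 1≤m m≤0 → contradiction m≤0 (<⇒≱ 1≤m)
  -- Hashing works with `suc v` bits; words of length 0 give a single address, too few for a
  -- nonempty text.
  index zero    σ σ≤2^w (c ∷ T)    α β fits _ = contradiction (≤-trans (m≤m*n 105 (length (c ∷ T))) fits) λ { (s≤s ()) }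
  index (suc v) σ σ≤2^w T@(_ ∷ _)  α β fits _ = I.D , ≤-trans (≤-reflexive I.length-D) I.space , I.Query.returns
    where module I = Index v σ σ≤2^w T α β (s≤s z≤n) fits
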